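{- Let $n(2,k)$ be the largest integer $n$ for which there exists a set $A$ of $k$ nonnegative integers such that $\{0,1,2,\ldots,n-1\}\subseteq 2A=\{a+a' : a,a'\in A\}$. Then \[ \limsup_{k\to\infty}\frac{n(2,k)}{k^2}\le 0.4789 . \]
   Context: For a set $A$ of integers, $2A=\{a+a' : a,a'\in A\}$ denotes its sumset. For a set $A$ of nonnegative integers, $n(2,A)=\max\{n : \{0,1,\ldots,n-1\}\subseteq 2A\}$, and $n(2,k)=\max\{n(2,A): A\subseteq \mathbb{N}_0,\ |A|=k\}$. -}

module Defs where

open import Data.Nat using (ℕ; _+_; _*_; _<_; _≤_; _^_)
open import Data.List using (List; length)
open import Data.List.Membership.Propositional using (_∈_)
open import Data.List.Relation.Unary.Unique.Propositional using (Unique)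
open import Data.Product using (Σ; _×_; ∃-syntax)
open import Relation.Binary.PropositionalEquality using (_≡_)

-- m ∈ 2A  (A a finite set of nonnegative integers, given as a duplicate-free list)
_∈2_ : ℕ → List ℕ → Set
m ∈2 A = ∃[ a ] ∃[ a' ] (a ∈ A × a' ∈ A × a + a' ≡ m)

Covers : List ℕ → ℕ → Set
Covers A n = ∀ m → m < n → m ∈2 A

IsKSet : ℕ → List ℕ → Set
IsKSet k A = Unique A × length A ≡ k

IsN2 : ℕ → ℕ → Set
IsN2 k n = (∃[ A ] (IsKSet k A × Covers A n))
         × (∀ A m → IsKSet k A → Covers A m → m ≤ n)

-- Suppose 10000 n > 4789 k² and put z_m = e^{π i m / n}, f_m = Σ_{a ∈ A} z_m^a. For every unit
-- vector e the weight 1 - ⟨e , z_m^x⟩ is nonnegative, so its sum over the pairs of A is at least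
-- twice its sum over x < n. Taking e along f_m² for m = 2, 4, 6, where Σ_{x<n} z_m^x = 0, gives
-- |f_m|² ≤ k² - 2n + O(k), Moser's bound. Taking e = -i for m = 1, where Σ_{x<n} z_1^x ≈ (2n/π) i,
-- gives k² + 2 Re f_1 Im f_1 ≥ 2n (1 + 2/π) - O(k), so (Re f_1 + Im f_1)² ≥ 4 Re f_1 Im f_1 is
-- large. On [0 , π] however cos φ + sin φ is at least -1 and at most a constant plus a
-- trigonometric polynomial in 2φ, 4φ, 6φ, so Moser's bounds make |Re f_1 + Im f_1| too small.
--
-- To stay in ℚ, cut [0 , n) into N = 1998 blocks of length q, replace x by the number of its block
-- and z_m by a rational point of the unit circle with angle close to π m / N. Adding block
-- numbers loses at most one carry, which costs the factor 1 - η with η ≥ |1 - z_m|.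
module Submission where

open import Defs
open import Data.Bool using (Bool; true; T; _∧_)
open import Data.Empty using (⊥)
open import Data.Integer as ℤ using (ℤ)
import Data.Integer.Properties as ℤ
open import Data.List using (List; []; _∷_; length; filter)
open import Data.List.Membership.Propositional using (_∈_)
open import Data.List.Membership.Propositional.Properties using (∈-filter⁺; ∈-filter⁻)
open import Data.List.Properties using (length-filter)
open import Data.List.Relation.Unary.Any using (here; there)
open import Data.Maybe using (Maybe; just; nothing)
import Data.Nat as ℕ
open import Data.Nat.Coprimality as Coprimality using (1-coprimeTo)
import Data.Nat.DivMod as ℕ
import Data.Nat.Divisibility as ℕ
import Data.Nat.Properties as ℕ
import Data.Nat.Tactic.RingSolver as ℕ
open import Data.Product using (_×_; _,_; proj₁; proj₂; ∃-syntax)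
open import Data.Rational.Unnormalised using (*≡*)
import Data.Rational.Unnormalised.Properties as ℚᵘ
open import Data.Sum using (_⊎_; inj₁; inj₂)
open import Data.Unit using (tt)
open import Level using (0ℓ)
open import Relation.Binary.PropositionalEquality
open import Relation.Nullary using (yes; no; contradiction)
open import Relation.Nullary.Decidable using (from-yes)
open import Tactic.RingSolver using (solve-∀)
open import Tactic.RingSolver.Core.AlmostCommutativeRing using (AlmostCommutativeRing; fromCommutativeRing)

module Proof where
  open import Data.Nat using (ℕ; zero; suc)
  open import Data.Rational
    using (ℚ; mkℚ; 0ℚ; 1ℚ; _/_; _+_; _*_; -_; _-_; _≤_; _<_; *≤*; nonNegative; positive)
  open import Data.Rational.Properties

  -- Ordered-field arithmetic in ℚ.

  ring : AlmostCommutativeRing 0ℓ 0ℓ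
  ring = fromCommutativeRing +-*-commutativeRing isZero
    where
    isZero : (x : ℚ) → Maybe (0ℚ ≡ x)
    isZero x with 0ℚ ≟ x
    ... | yes eq = just eq
    ... | no  _  = nothing

  0≤+ : ∀ {x y} → 0ℚ ≤ x → 0ℚ ≤ y → 0ℚ ≤ x + y
  0≤+ p q = +-mono-≤ p q

  *-monoˡ : ∀ {x y} r → 0ℚ ≤ r → x ≤ y → r * x ≤ r * y
  *-monoˡ r p = *-monoˡ-≤-nonNeg r {{nonNegative p}}

  *-monoʳ : ∀ {x y} r → 0ℚ ≤ r → x ≤ y → x * r ≤ y * r
  *-monoʳ r p = *-monoʳ-≤-nonNeg r {{nonNegative p}}

  0≤* : ∀ {x y} → 0ℚ ≤ x → 0ℚ ≤ y → 0ℚ ≤ x * y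
  0≤* {x} {y} p q = subst (_≤ x * y) (*-zeroʳ x) (*-monoˡ x p q)

  0<* : ∀ {x y} → 0ℚ < x → 0ℚ < y → 0ℚ < x * y
  0<* {x} {y} p q = subst (_< x * y) (*-zeroʳ x) (*-monoʳ-<-pos x {{positive p}} q)

  ≤⇒0≤- : ∀ {x y} → x ≤ y → 0ℚ ≤ y - x
  ≤⇒0≤- {x} {y} p = subst (_≤ y - x) (+-inverseʳ x) (+-monoˡ-≤ (- x) p)

  0≤-⇒≤ : ∀ {x y} → 0ℚ ≤ y - x → x ≤ y
  0≤-⇒≤ {x} {y} p = subst₂ _≤_ (+-identityʳ x) (eq x y) (+-monoʳ-≤ x p)
    where
    eq : ∀ x y → x + (y - x) ≡ y
    eq = solve-∀ ring

  -- Splits an inequality into a ring identity for the solver and a nonnegative remainder; many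
  -- estimates below are given in this form.
  ≤-by : ∀ {x y d} → y - x ≡ d → 0ℚ ≤ d → x ≤ y
  ≤-by eq p = 0≤-⇒≤ (subst (0ℚ ≤_) (sym eq) p)

  0≤square : ∀ x → 0ℚ ≤ x * x
  0≤square x with ≤-total 0ℚ x
  ... | inj₁ p = 0≤* p p
  ... | inj₂ p = subst (0ℚ ≤_) (eq x) (0≤* (neg-antimono-≤ p) (neg-antimono-≤ p))
    where
    eq : ∀ x → (- x) * (- x) ≡ x * x
    eq = solve-∀ ring

  x²≤y²⇒x≤y : ∀ {x y} → 0ℚ ≤ y → x * x ≤ y * y → x ≤ y
  x²≤y²⇒x≤y {x} {y} 0≤y xx≤yy with x ≤? y
  ... | yes p = p
  ... | no ¬p = contradiction (<-≤-trans yy<xx xx≤yy) (<-irrefl refl)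
    where
    y<x = ≰⇒> ¬p
    yy<xx : y * y < x * x
    yy<xx = ≤-<-trans (*-monoˡ y 0≤y (<⇒≤ y<x))
      (*-monoˡ-<-pos x {{positive (≤-<-trans 0≤y y<x)}} y<x)

  -- Cancels a factor that may be zero: if `y < x`, then `0 ≤ y` makes `x` positive, and multiplying
  -- by it gives `x * y < x * x`.
  x²≤xy⇒x≤y : ∀ {x y} → 0ℚ ≤ x → 0ℚ ≤ y → x * x ≤ x * y → x ≤ y
  x²≤xy⇒x≤y {x} {y} 0≤x 0≤y xx≤xy with x ≤? y
  ... | yes p = p
  ... | no ¬p = contradiction (<-≤-trans xy<xx xx≤xy) (<-irrefl refl)
    where
    y<x = ≰⇒> ¬p
    xy<xx : x * y < x * x
    xy<xx = *-monoʳ-<-pos x {{positive (≤-<-trans 0≤y y<x)}} y<x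

  -- Lagrange's identity: the defect in the Cauchy-Schwarz inequality is the square of
  -- `u * q - v * p`. Comparing with the square of a given `ρ` avoids square roots, so everything
  -- stays in ℚ.
  cauchy : ∀ u v p q {ρ} → 0ℚ ≤ ρ → (u * u + v * v) * (p * p + q * q) ≤ ρ * ρ → u * p + v * q ≤ ρ
  cauchy u v p q 0≤ρ h = x²≤y²⇒x≤y 0≤ρ (≤-trans (≤-by (eq u v p q) (0≤square (u * q - v * p))) h)
    where
    eq : ∀ u v p q → (u * u + v * v) * (p * p + q * q) - (u * p + v * q) * (u * p + v * q)
                     ≡ (u * q - v * p) * (u * q - v * p)
    eq = solve-∀ ring

  -- Integers and naturals inside ℚ.

  fromℤ : ℤ → ℚ
  -- The denominator 1 is written out instead of using `_/_`, so no gcd normalisation stands in the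
  -- way of the homomorphism laws.
  fromℤ i = mkℚ i 0 (Coprimality.sym (1-coprimeTo ℤ.∣ i ∣))

  fromℤ-+ : ∀ i j → fromℤ (i ℤ.+ j) ≡ fromℤ i + fromℤ j
  fromℤ-+ i j = toℚᵘ-injective (ℚᵘ.≃-trans (*≡* eq) (ℚᵘ.≃-sym (toℚᵘ-homo-+ (fromℤ i) (fromℤ j))))
    where
    eq : (i ℤ.+ j) ℤ.* (ℤ.+ 1) ≡ (i ℤ.* (ℤ.+ 1) ℤ.+ j ℤ.* (ℤ.+ 1)) ℤ.* (ℤ.+ 1)
    eq = cong (ℤ._* (ℤ.+ 1)) (sym (cong₂ ℤ._+_ (ℤ.*-identityʳ i) (ℤ.*-identityʳ j)))

  fromℤ-* : ∀ i j → fromℤ (i ℤ.* j) ≡ fromℤ i * fromℤ j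
  fromℤ-* i j = toℚᵘ-injective (ℚᵘ.≃-trans (*≡* refl) (ℚᵘ.≃-sym (toℚᵘ-homo-* (fromℤ i) (fromℤ j))))

  fromℤ-neg : ∀ i → fromℤ (ℤ.- i) ≡ - fromℤ i
  fromℤ-neg (ℤ.+ zero) = refl
  fromℤ-neg (ℤ.+ suc n) = refl
  fromℤ-neg ℤ.-[1+ n ] = refl

  fromℤ-≤ : ∀ {i j} → i ℤ.≤ j → fromℤ i ≤ fromℤ j
  fromℤ-≤ {i} {j} p = *≤* (subst₂ ℤ._≤_ (sym (ℤ.*-identityʳ i)) (sym (ℤ.*-identityʳ j)) p)

  fromℕ : ℕ → ℚ
  fromℕ n = fromℤ (ℤ.+ n)

  fromℕ-suc : ∀ n → fromℕ (suc n) ≡ 1ℚ + fromℕ n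
  fromℕ-suc n = fromℤ-+ (ℤ.+ 1) (ℤ.+ n)

  fromℕ-≤ : ∀ {m n} → m ℕ.≤ n → fromℕ m ≤ fromℕ n
  fromℕ-≤ p = fromℤ-≤ (ℤ.+≤+ p)

  0≤fromℕ : ∀ n → 0ℚ ≤ fromℕ n
  0≤fromℕ n = fromℕ-≤ ℕ.z≤n

  fromℕ-* : ∀ m n → fromℕ (m ℕ.* n) ≡ fromℕ m * fromℕ n
  fromℕ-* m n = trans (cong fromℤ (ℤ.pos-* m n)) (fromℤ-* (ℤ.+ m) (ℤ.+ n))

  -- Finite sums and division into blocks.

  sumTo : ℕ → (ℕ → ℚ) → ℚ
  sumTo zero    f = 0ℚ
  sumTo (suc n) f = sumTo n f + f n

  sumOver : (ℕ → ℚ) → List ℕ → ℚ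
  sumOver f []       = 0ℚ
  sumOver f (x ∷ xs) = f x + sumOver f xs

  sumTo-cong : ∀ n {f g} → (∀ m → m ℕ.< n → f m ≡ g m) → sumTo n f ≡ sumTo n g
  sumTo-cong zero    h = refl
  sumTo-cong (suc n) h = cong₂ _+_ (sumTo-cong n (λ m p → h m (ℕ.m<n⇒m<1+n p))) (h n (ℕ.n<1+n n))

  sumTo-mono : ∀ n {f g} → (∀ m → m ℕ.< n → f m ≤ g m) → sumTo n f ≤ sumTo n g
  sumTo-mono zero    h = ≤-refl
  sumTo-mono (suc n) h = +-mono-≤ (sumTo-mono n (λ m p → h m (ℕ.m<n⇒m<1+n p))) (h n (ℕ.n<1+n n))

  sumTo-+ : ∀ m n f → sumTo (m ℕ.+ n) f ≡ sumTo m f + sumTo n (λ j → f (m ℕ.+ j))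
  sumTo-+ m zero    f = trans (cong (λ t → sumTo t f) (ℕ.+-identityʳ m)) (sym (+-identityʳ _))
  sumTo-+ m (suc n) f = begin
    sumTo (m ℕ.+ suc n) f                                              ≡⟨ cong (λ t → sumTo t f) (ℕ.+-suc m n) ⟩
    sumTo (m ℕ.+ n) f + f (m ℕ.+ n)                                    ≡⟨ cong (_+ f (m ℕ.+ n)) (sumTo-+ m n f) ⟩
    sumTo m f + sumTo n (λ j → f (m ℕ.+ j)) + f (m ℕ.+ n)              ≡⟨ +-assoc (sumTo m f) _ _ ⟩
    sumTo m f + (sumTo n (λ j → f (m ℕ.+ j)) + f (m ℕ.+ n))            ∎
    where open ≡-Reasoning

  sumTo-const : ∀ n x → sumTo n (λ _ → x) ≡ fromℕ n * x
  sumTo-const zero    x = sym (*-zeroˡ x)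
  sumTo-const (suc n) x = begin
    sumTo n (λ _ → x) + x ≡⟨ cong (_+ x) (sumTo-const n x) ⟩
    fromℕ n * x + x       ≡⟨ eq (fromℕ n) x ⟩
    (1ℚ + fromℕ n) * x    ≡⟨ cong (_* x) (fromℕ-suc n) ⟨
    fromℕ (suc n) * x     ∎
    where
    open ≡-Reasoning
    eq : ∀ n x → n * x + x ≡ (1ℚ + n) * x
    eq = solve-∀ ring

  sumTo-blocks : ∀ q N .{{_ : ℕ.NonZero q}} (f : ℕ → ℚ) →
                 sumTo (N ℕ.* q) (λ m → f (m ℕ./ q)) ≡ fromℕ q * sumTo N f
  sumTo-blocks q zero    f = sym (*-zeroʳ (fromℕ q))
  sumTo-blocks q (suc N) f = begin
    sumTo (q ℕ.+ N ℕ.* q) g                                   ≡⟨ cong (λ t → sumTo t g) (ℕ.+-comm q (N ℕ.* q)) ⟩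
    sumTo (N ℕ.* q ℕ.+ q) g                                   ≡⟨ sumTo-+ (N ℕ.* q) q g ⟩
    sumTo (N ℕ.* q) g + sumTo q (λ j → g (N ℕ.* q ℕ.+ j))     ≡⟨ cong (sumTo (N ℕ.* q) g +_) (sumTo-cong q block) ⟩
    sumTo (N ℕ.* q) g + sumTo q (λ _ → f N)                   ≡⟨ cong₂ _+_ (sumTo-blocks q N f) (sumTo-const q (f N)) ⟩
    fromℕ q * sumTo N f + fromℕ q * f N                       ≡⟨ *-distribˡ-+ (fromℕ q) (sumTo N f) (f N) ⟨
    fromℕ q * (sumTo N f + f N)                               ∎
    where
    open ≡-Reasoning
    g : ℕ → ℚ
    g m = f (m ℕ./ q)
    block : ∀ j → j ℕ.< q → g (N ℕ.* q ℕ.+ j) ≡ f N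
    block j j<q = cong f (begin
      (N ℕ.* q ℕ.+ j) ℕ./ q       ≡⟨ ℕ.+-distrib-/-∣ˡ j (ℕ.n∣m*n N) ⟩
      N ℕ.* q ℕ./ q ℕ.+ j ℕ./ q   ≡⟨ cong₂ ℕ._+_ (ℕ.m*n/n≡m N q) (ℕ.m<n⇒m/n≡0 j<q) ⟩
      N ℕ.+ 0                     ≡⟨ ℕ.+-identityʳ N ⟩
      N                           ∎)

  sumOver-mono : ∀ L {f g} → (∀ {x} → x ∈ L → f x ≤ g x) → sumOver f L ≤ sumOver g L
  sumOver-mono []      h = ≤-refl
  sumOver-mono (x ∷ L) h = +-mono-≤ (h (here refl)) (sumOver-mono L (λ p → h (there p)))

  sumOver-const : ∀ x L → sumOver (λ _ → x) L ≡ fromℕ (length L) * x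
  sumOver-const x []      = sym (*-zeroˡ x)
  sumOver-const x (_ ∷ L) = begin
    x + sumOver (λ _ → x) L         ≡⟨ cong (x +_) (sumOver-const x L) ⟩
    x + fromℕ (length L) * x        ≡⟨ eq (fromℕ (length L)) x ⟩
    (1ℚ + fromℕ (length L)) * x     ≡⟨ cong (_* x) (fromℕ-suc (length L)) ⟨
    fromℕ (suc (length L)) * x      ∎
    where
    open ≡-Reasoning
    eq : ∀ n x → x + n * x ≡ (1ℚ + n) * x
    eq = solve-∀ ring
  sumOver-cong : ∀ L {f g} → (∀ x → f x ≡ g x) → sumOver f L ≡ sumOver g L
  sumOver-cong []      h = refl
  sumOver-cong (x ∷ L) h = cong₂ _+_ (h x) (sumOver-cong L h)

  -- With one member of a pair fixed, its weight is a constant plus a linear form in a cosine and a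
  -- sine; such sums reduce to the size of the list and two moments.
  sumOver-affine : ∀ r u v f g L → sumOver (λ x → r + (u * f x + v * g x)) L
                   ≡ fromℕ (length L) * r + (u * sumOver f L + v * sumOver g L)
  sumOver-affine r u v f g []      = eq r u v
    where
    eq : ∀ r u v → 0ℚ ≡ 0ℚ * r + (u * 0ℚ + v * 0ℚ)
    eq = solve-∀ ring
  sumOver-affine r u v f g (x ∷ L)
    rewrite sumOver-affine r u v f g L | fromℕ-suc (length L)
    = eq r u v (f x) (g x) (fromℕ (length L)) (sumOver f L) (sumOver g L)
    where
    eq : ∀ r u v a b l s t → r + (u * a + v * b) + (l * r + (u * s + v * t))
         ≡ (1ℚ + l) * r + (u * (a + s) + v * (b + t))
    eq = solve-∀ ring

  sumOver-linear : ∀ u v f g L → sumOver (λ x → u * f x + v * g x) L ≡ u * sumOver f L + v * sumOver g L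
  sumOver-linear u v f g L = begin
    sumOver (λ x → u * f x + v * g x) L            ≡⟨ sumOver-cong L (λ x → sym (+-identityˡ (u * f x + v * g x))) ⟩
    sumOver (λ x → 0ℚ + (u * f x + v * g x)) L     ≡⟨ sumOver-affine 0ℚ u v f g L ⟩
    fromℕ (length L) * 0ℚ + rhs                    ≡⟨ cong (_+ rhs) (*-zeroʳ (fromℕ (length L))) ⟩
    0ℚ + rhs                                       ≡⟨ +-identityˡ rhs ⟩
    rhs                                            ∎
    where
    open ≡-Reasoning
    rhs = u * sumOver f L + v * sumOver g L

  sumTo-affine : ∀ r u v f g n → sumTo n (λ m → r + (u * f m + v * g m))
                 ≡ fromℕ n * r + (u * sumTo n f + v * sumTo n g)
  sumTo-affine r u v f g zero    = eq r u v
    where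
    eq : ∀ r u v → 0ℚ ≡ 0ℚ * r + (u * 0ℚ + v * 0ℚ)
    eq = solve-∀ ring
  sumTo-affine r u v f g (suc n)
    rewrite sumTo-affine r u v f g n | fromℕ-suc n
    = eq r u v (f n) (g n) (fromℕ n) (sumTo n f) (sumTo n g)
    where
    eq : ∀ r u v a b l s t → (l * r + (u * s + v * t)) + (r + (u * a + v * b))
         ≡ (1ℚ + l) * r + (u * (s + a) + v * (t + b))
    eq = solve-∀ ring

  -- Sums over unordered and ordered pairs.

  pairSum : (ℕ → ℕ → ℚ) → List ℕ → ℚ
  pairSum F []       = 0ℚ
  pairSum F (x ∷ xs) = F x x + sumOver (F x) xs + pairSum F xs

  squareSum : (ℕ → ℕ → ℚ) → List ℕ → ℚ
  squareSum F L = sumOver (λ x → sumOver (F x) L) L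

  sumOver-+ : ∀ f g L → sumOver (λ x → f x + g x) L ≡ sumOver f L + sumOver g L
  sumOver-+ f g []      = refl
  sumOver-+ f g (x ∷ L) rewrite sumOver-+ f g L = eq (f x) (g x) (sumOver f L) (sumOver g L)
    where
    eq : ∀ a b c d → (a + b) + (c + d) ≡ (a + c) + (b + d)
    eq = solve-∀ ring

  -- Off the diagonal each unordered pair occurs twice in the square, on it once, hence the added
  -- diagonal. Symmetry turns the `column` of the new element into its row.
  pairSum-double : ∀ F → (∀ x y → F x y ≡ F y x) → ∀ L →
                   pairSum F L + pairSum F L ≡ squareSum F L + sumOver (λ x → F x x) L
  pairSum-double F F-sym []      = refl
  pairSum-double F F-sym (x ∷ L) = begin
    d + r + p + (d + r + p)              ≡⟨ eq₁ d r p ⟩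
    d + r + (r + d) + (p + p)            ≡⟨ cong (d + r + (r + d) +_) (pairSum-double F F-sym L) ⟩
    d + r + (r + d) + (sq + e)           ≡⟨ eq₂ d r sq e ⟩
    d + r + (r + sq) + (d + e)           ≡⟨ cong (λ t → d + r + t + (d + e)) column ⟨
    squareSum F (x ∷ L) + sumOver (λ x → F x x) (x ∷ L) ∎
    where
    open ≡-Reasoning
    d = F x x
    r = sumOver (F x) L
    p = pairSum F L
    sq = squareSum F L
    e = sumOver (λ x → F x x) L
    column : sumOver (λ y → F y x + sumOver (F y) L) L ≡ r + sq
    column = trans (sumOver-+ (λ y → F y x) (λ y → sumOver (F y) L) L)
                   (cong (_+ sq) (sumOver-cong L (λ y → F-sym y x)))
    eq₁ : ∀ d r p → d + r + p + (d + r + p) ≡ d + r + (r + d) + (p + p)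
    eq₁ = solve-∀ ring
    eq₂ : ∀ d r sq e → d + r + (r + d) + (sq + e) ≡ d + r + (r + sq) + (d + e)
    eq₂ = solve-∀ ring

  0≤sumOver : ∀ f → (∀ x → 0ℚ ≤ f x) → ∀ L → 0ℚ ≤ sumOver f L
  0≤sumOver f h []      = ≤-refl
  0≤sumOver f h (x ∷ L) = 0≤+ (h x) (0≤sumOver f h L)

  ≤-+ʳ : ∀ {x y z} → x ≤ y → 0ℚ ≤ z → x ≤ y + z
  ≤-+ʳ {x} {y} {z} p q = subst (_≤ y + z) (+-identityʳ x) (+-mono-≤ p q)

  ≤-+ˡ : ∀ {x y z} → x ≤ y → 0ℚ ≤ z → x ≤ z + y
  ≤-+ˡ {x} {y} {z} p q = subst (_≤ z + y) (+-identityˡ x) (+-mono-≤ q p)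

  ∈⇒≤sumOver : ∀ f → (∀ x → 0ℚ ≤ f x) → ∀ {x L} → x ∈ L → f x ≤ sumOver f L
  ∈⇒≤sumOver f h {L = y ∷ L} (here refl) = ≤-+ʳ ≤-refl (0≤sumOver f h L)
  ∈⇒≤sumOver f h {L = y ∷ L} (there p)   = ≤-+ˡ (∈⇒≤sumOver f h p) (h y)

  0≤pairSum : ∀ F → (∀ x y → 0ℚ ≤ F x y) → ∀ L → 0ℚ ≤ pairSum F L
  0≤pairSum F h []      = ≤-refl
  0≤pairSum F h (x ∷ L) = 0≤+ (0≤+ (h x x) (0≤sumOver (F x) (h x) L)) (0≤pairSum F h L)

  -- The pair sum keeps one order of each pair; symmetry supplies the other when `y` precedes `x` in
  -- the list.
  ∈⇒≤pairSum : ∀ F → (∀ x y → F x y ≡ F y x) → (∀ x y → 0ℚ ≤ F x y) →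
               ∀ {x y L} → x ∈ L → y ∈ L → F x y ≤ pairSum F L
  ∈⇒≤pairSum F F-sym h {L = z ∷ L} (here refl) (here refl) =
    ≤-+ʳ (≤-+ʳ ≤-refl (0≤sumOver (F z) (h z) L)) (0≤pairSum F h L)
  ∈⇒≤pairSum F F-sym h {L = z ∷ L} (here refl) (there q) =
    ≤-+ʳ (≤-+ˡ (∈⇒≤sumOver (F z) (h z) q) (h z z)) (0≤pairSum F h L)
  ∈⇒≤pairSum F F-sym h {x} {L = z ∷ L} (there p) (here refl) =
    subst (_≤ pairSum F (z ∷ L)) (F-sym z x)
      (≤-+ʳ (≤-+ˡ (∈⇒≤sumOver (F z) (h z) p) (h z z)) (0≤pairSum F h L))
  ∈⇒≤pairSum F F-sym h {L = z ∷ L} (there p) (there q) =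
    ≤-+ˡ (∈⇒≤pairSum F F-sym h p q) (0≤+ (h z z) (0≤sumOver (F z) (h z) L))

  pairSum-mono : ∀ {F G} → (∀ x y → F x y ≤ G x y) → ∀ L → pairSum F L ≤ pairSum G L
  pairSum-mono h []      = ≤-refl
  pairSum-mono h (x ∷ L) =
    +-mono-≤ (+-mono-≤ (h x x) (sumOver-mono L (λ {y} _ → h x y))) (pairSum-mono h L)

  pairSum-+ : ∀ F G L → pairSum (λ x y → F x y + G x y) L ≡ pairSum F L + pairSum G L
  pairSum-+ F G []      = refl
  pairSum-+ F G (x ∷ L) rewrite pairSum-+ F G L | sumOver-+ (F x) (G x) L =
    eq (F x x) (G x x) (sumOver (F x) L) (sumOver (G x) L) (pairSum F L) (pairSum G L)
    where
    eq : ∀ a b c d e f → a + b + (c + d) + (e + f) ≡ a + c + e + (b + d + f)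
    eq = solve-∀ ring

  pairSum-zero : ∀ L → pairSum (λ _ _ → 0ℚ) L ≡ 0ℚ
  pairSum-zero []      = refl
  pairSum-zero (x ∷ L) rewrite sumOver-const 0ℚ L | pairSum-zero L = eq (fromℕ (length L))
    where
    eq : ∀ l → 0ℚ + l * 0ℚ + 0ℚ ≡ 0ℚ
    eq = solve-∀ ring

  -- Counting represented numbers by pairs.

  sumTo-pairSum : ∀ n (F : ℕ → ℕ → ℕ → ℚ) L →
                  sumTo n (λ m → pairSum (F m) L) ≡ pairSum (λ x y → sumTo n (λ m → F m x y)) L
  sumTo-pairSum zero    F L = sym (pairSum-zero L)
  sumTo-pairSum (suc n) F L = trans (cong (_+ pairSum (F n) L) (sumTo-pairSum n F L))
    (sym (pairSum-+ (λ x y → sumTo n (λ m → F m x y)) (F n) L))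

  -- Point mass `v` at `s`. Placing the weight of a pair at its sum allows the sums over numbers and
  -- over pairs to be interchanged.
  only : ℕ → ℚ → ℕ → ℚ
  only s v m with m ℕ.≟ s
  ... | yes _ = v
  ... | no  _ = 0ℚ

  only-self : ∀ s v → only s v s ≡ v
  only-self s v with s ℕ.≟ s
  ... | yes _ = refl
  ... | no ¬p = contradiction refl ¬p

  0≤only : ∀ s {v} m → 0ℚ ≤ v → 0ℚ ≤ only s v m
  0≤only s m p with m ℕ.≟ s
  ... | yes _ = p
  ... | no  _ = ≤-refl

  sumTo-only-below : ∀ s v n → n ℕ.≤ s → sumTo n (only s v) ≡ 0ℚ
  sumTo-only-below s v zero    p = refl
  sumTo-only-below s v (suc n) p with n ℕ.≟ s
  ... | yes refl = contradiction p (ℕ.n≮n n)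
  ... | no  _    = trans (+-identityʳ (sumTo n (only s v))) (sumTo-only-below s v n (ℕ.<⇒≤ p))

  sumTo-only : ∀ s {v} n → 0ℚ ≤ v → sumTo n (only s v) ≤ v
  sumTo-only s     zero    p = p
  sumTo-only s {v} (suc n) p with n ℕ.≟ s
  ... | yes refl = ≤-reflexive (trans (cong (_+ v) (sumTo-only-below s v n ℕ.≤-refl)) (+-identityˡ v))
  ... | no  _    = subst (_≤ v) (sym (+-identityʳ (sumTo n (only s v)))) (sumTo-only s n p)

  -- Double counting. At each `m` a pair representing it contributes at least `G m`; conversely a
  -- pair has a single sum, so over all `m` it contributes at most its own weight.
  sumTo≤pairSum : ∀ n (G : ℕ → ℚ) F L →
    (∀ m → m ℕ.< n → ∃[ a ] ∃[ b ] (a ∈ L × b ∈ L × a ℕ.+ b ≡ m)) →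
    (∀ a b → F a b ≡ F b a) → (∀ a b → 0ℚ ≤ F a b) → (∀ a b → G (a ℕ.+ b) ≤ F a b) →
    sumTo n G ≤ pairSum F L
  sumTo≤pairSum n G F L cover F-sym 0≤F G≤F = begin
    sumTo n G                                    ≤⟨ sumTo-mono n represented ⟩
    sumTo n (λ m → pairSum (F′ m) L)             ≡⟨ sumTo-pairSum n F′ L ⟩
    pairSum (λ a b → sumTo n (λ m → F′ m a b)) L ≤⟨ pairSum-mono (λ a b → sumTo-only (a ℕ.+ b) n (0≤F a b)) L ⟩
    pairSum F L                                  ∎
    where
    open ≤-Reasoning
    F′ : ℕ → ℕ → ℕ → ℚ
    F′ m a b = only (a ℕ.+ b) (F a b) m
    represented : ∀ m → m ℕ.< n → G m ≤ pairSum (F′ m) L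
    represented m m<n with cover m m<n
    ... | a , b , a∈L , b∈L , refl = ≤-trans
      (subst (G (a ℕ.+ b) ≤_) (sym (only-self (a ℕ.+ b) (F a b))) (G≤F a b))
      (∈⇒≤pairSum (F′ (a ℕ.+ b)) (λ x y → cong₂ (λ s v → only s v (a ℕ.+ b)) (ℕ.+-comm x y) (F-sym x y))
        (λ x y → 0≤only (x ℕ.+ y) (a ℕ.+ b) (0≤F x y)) a∈L b∈L)

  -- Two remainders add up to less than `2 q`, so block numbers add with a carry of 0 or 1.
  /-+ : ∀ a b q .{{_ : ℕ.NonZero q}} →
        (a ℕ.+ b) ℕ./ q ≡ a ℕ./ q ℕ.+ b ℕ./ q ⊎ (a ℕ.+ b) ℕ./ q ≡ suc (a ℕ./ q ℕ.+ b ℕ./ q)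
  /-+ a b q = split carry refl
    where
    open ≡-Reasoning
    r = a ℕ.% q ℕ.+ b ℕ.% q
    i = a ℕ./ q
    j = b ℕ./ q
    carry : r ℕ./ q ℕ.< 2
    carry = ℕ.m<n*o⇒m/o<n (subst (r ℕ.<_) (cong (q ℕ.+_) (sym (ℕ.+-identityʳ q)))
      (ℕ.+-mono-< (ℕ.m%n<n a q) (ℕ.m%n<n b q)))
    quotient : (a ℕ.+ b) ℕ./ q ≡ r ℕ./ q ℕ.+ (i ℕ.+ j)
    quotient = begin
      (a ℕ.+ b) ℕ./ q                  ≡⟨ cong (ℕ._/ q) (cong₂ ℕ._+_ (ℕ.m≡m%n+[m/n]*n a q) (ℕ.m≡m%n+[m/n]*n b q)) ⟩
      (a ℕ.% q ℕ.+ i ℕ.* q ℕ.+ (b ℕ.% q ℕ.+ j ℕ.* q)) ℕ./ q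
        ≡⟨ cong (ℕ._/ q) (ℕ+-interchange (a ℕ.% q) (i ℕ.* q) (b ℕ.% q) (j ℕ.* q)) ⟩
      (r ℕ.+ (i ℕ.* q ℕ.+ j ℕ.* q)) ℕ./ q ≡⟨ cong (λ t → (r ℕ.+ t) ℕ./ q) (ℕ.*-distribʳ-+ q i j) ⟨
      (r ℕ.+ (i ℕ.+ j) ℕ.* q) ℕ./ q    ≡⟨ ℕ.+-distrib-/-∣ʳ r (ℕ.n∣m*n (i ℕ.+ j)) ⟩
      r ℕ./ q ℕ.+ (i ℕ.+ j) ℕ.* q ℕ./ q ≡⟨ cong (r ℕ./ q ℕ.+_) (ℕ.m*n/n≡m (i ℕ.+ j) q) ⟩
      r ℕ./ q ℕ.+ (i ℕ.+ j)            ∎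
      where
      ℕ+-interchange : ∀ w x y z → w ℕ.+ x ℕ.+ (y ℕ.+ z) ≡ w ℕ.+ y ℕ.+ (x ℕ.+ z)
      ℕ+-interchange w x y z = begin
        w ℕ.+ x ℕ.+ (y ℕ.+ z)   ≡⟨ ℕ.+-assoc w x (y ℕ.+ z) ⟩
        w ℕ.+ (x ℕ.+ (y ℕ.+ z)) ≡⟨ cong (w ℕ.+_) (ℕ.+-assoc x y z) ⟨
        w ℕ.+ (x ℕ.+ y ℕ.+ z)   ≡⟨ cong (λ t → w ℕ.+ (t ℕ.+ z)) (ℕ.+-comm x y) ⟩
        w ℕ.+ (y ℕ.+ x ℕ.+ z)   ≡⟨ cong (w ℕ.+_) (ℕ.+-assoc y x z) ⟩
        w ℕ.+ (y ℕ.+ (x ℕ.+ z)) ≡⟨ ℕ.+-assoc w y (x ℕ.+ z) ⟨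
        w ℕ.+ y ℕ.+ (x ℕ.+ z)   ∎
    split : ∀ {t} → t ℕ.< 2 → r ℕ./ q ≡ t →
            (a ℕ.+ b) ℕ./ q ≡ i ℕ.+ j ⊎ (a ℕ.+ b) ℕ./ q ≡ suc (i ℕ.+ j)
    split {zero}        _ eq = inj₁ (trans quotient (cong (ℕ._+ (i ℕ.+ j)) eq))
    split {suc zero}    _ eq = inj₂ (trans quotient (cong (ℕ._+ (i ℕ.+ j)) eq))
    split {suc (suc _)} (ℕ.s≤s (ℕ.s≤s ())) _

  -- Powers of a rational point on the unit circle.

  module Rotation (c s : ℚ) (unit : c * c + s * s ≡ 1ℚ) where

    -- Real and imaginary parts of the powers of `z = c + s i`.
    C S : ℕ → ℚ
    C zero    = 1ℚ
    C (suc i) = c * C i - s * S i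
    S zero    = 0ℚ
    S (suc i) = s * C i + c * S i

    C-+ : ∀ i j → C (i ℕ.+ j) ≡ C i * C j - S i * S j
    S-+ : ∀ i j → S (i ℕ.+ j) ≡ S i * C j + C i * S j
    C-+ zero    j = eq (C j) (S j)
      where
      eq : ∀ x y → x ≡ 1ℚ * x - 0ℚ * y
      eq = solve-∀ ring
    C-+ (suc i) j rewrite C-+ i j | S-+ i j = eq c s (C i) (S i) (C j) (S j)
      where
      eq : ∀ c s x y x′ y′ → c * (x * x′ - y * y′) - s * (y * x′ + x * y′)
           ≡ (c * x - s * y) * x′ - (s * x + c * y) * y′
      eq = solve-∀ ring
    S-+ zero    j = eq (C j) (S j)
      where
      eq : ∀ x y → y ≡ 0ℚ * x + 1ℚ * y
      eq = solve-∀ ring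
    S-+ (suc i) j rewrite C-+ i j | S-+ i j = eq c s (C i) (S i) (C j) (S j)
      where
      eq : ∀ c s x y x′ y′ → s * (x * x′ - y * y′) + c * (y * x′ + x * y′)
           ≡ (s * x + c * y) * x′ + (c * x - s * y) * y′
      eq = solve-∀ ring

    norm : ∀ i → C i * C i + S i * S i ≡ 1ℚ
    norm zero    = refl
    norm (suc i) = trans (eq c s (C i) (S i)) (cong₂ _*_ unit (norm i))
      where
      eq : ∀ c s x y → (c * x - s * y) * (c * x - s * y) + (s * x + c * y) * (s * x + c * y)
           ≡ (c * c + s * s) * (x * x + y * y)
      eq = solve-∀ ring

    dot≤ : ∀ g₁ g₂ {R} → 0ℚ ≤ R → g₁ * g₁ + g₂ * g₂ ≡ R * R → ∀ i → g₁ * C i + g₂ * S i ≤ R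
    dot≤ g₁ g₂ {R} 0≤R g i = cauchy g₁ g₂ (C i) (S i) 0≤R
      (≤-reflexive (trans (cong₂ _*_ g (norm i)) (*-identityʳ (R * R))))

    -- Consecutive powers differ by `1 - z` times a unit vector, so a carry changes the inner
    -- product with a vector of length `R` by at most `R * η`.
    dot-step≤ : ∀ g₁ g₂ {R η} → 0ℚ ≤ R → g₁ * g₁ + g₂ * g₂ ≡ R * R →
      0ℚ ≤ η → (1ℚ - c) * (1ℚ - c) + s * s ≤ η * η →
      ∀ i → g₁ * (C i - C (suc i)) + g₂ * (S i - S (suc i)) ≤ R * η
    dot-step≤ g₁ g₂ {R} {η} 0≤R g 0≤η h i = cauchy g₁ g₂ (C i - C (suc i)) (S i - S (suc i)) (0≤* 0≤R 0≤η)
      (begin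
        (g₁ * g₁ + g₂ * g₂) * step²       ≡⟨ cong₂ _*_ g (eq₁ c s (C i) (S i)) ⟩
        (R * R) * (d * (C i * C i + S i * S i)) ≡⟨ cong (λ t → (R * R) * (d * t)) (norm i) ⟩
        (R * R) * (d * 1ℚ)               ≡⟨ cong ((R * R) *_) (*-identityʳ d) ⟩
        (R * R) * d                      ≤⟨ *-monoˡ (R * R) (0≤square R) h ⟩
        (R * R) * (η * η)                ≡⟨ eq₂ R η ⟩
        (R * η) * (R * η)                ∎)
      where
      open ≤-Reasoning
      d = (1ℚ - c) * (1ℚ - c) + s * s
      step² = (C i - C (suc i)) * (C i - C (suc i)) + (S i - S (suc i)) * (S i - S (suc i))
      eq₁ : ∀ c s x y → (x - (c * x - s * y)) * (x - (c * x - s * y)) + (y - (s * x + c * y)) * (y - (s * x + c * y))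
            ≡ ((1ℚ - c) * (1ℚ - c) + s * s) * (x * x + y * y)
      eq₁ = solve-∀ ring
      eq₂ : ∀ R η → (R * R) * (η * η) ≡ (R * η) * (R * η)
      eq₂ = solve-∀ ring

    -- Moment inequalities for a covering set.

    module _ (q N : ℕ) .{{_ : ℕ.NonZero q}} (L : List ℕ)
             (cover : ∀ m → m ℕ.< N ℕ.* q → ∃[ a ] ∃[ b ] (a ∈ L × b ∈ L × a ℕ.+ b ≡ m)) where

      -- Real and imaginary parts of the exponential sum `f` over the block numbers of `L`.
      P Q : ℚ
      P = sumOver (λ a → C (a ℕ./ q)) L
      Q = sumOver (λ a → S (a ℕ./ q)) L

      private
        l : ℚ
        l = fromℕ (length L)

      module _ (g₁ g₂ R η : ℚ) (0≤R : 0ℚ ≤ R) (g : g₁ * g₁ + g₂ * g₂ ≡ R * R)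
               (0≤η : 0ℚ ≤ η) (step : (1ℚ - c) * (1ℚ - c) + s * s ≤ η * η) where

        private
          -- Nonnegative weight of a pair of blocks. The direction `g` has length `R` and is not
          -- normalised, so that `g = f²` with `R = |f|²` stays rational.
          F : ℕ → ℕ → ℚ
          F a b = R - (g₁ * C (a ℕ./ q ℕ.+ b ℕ./ q) + g₂ * S (a ℕ./ q ℕ.+ b ℕ./ q))

          -- The weight as a function of the block of the sum, lowered by `R * η` to stay below `F`
          -- even when adding block numbers loses a carry.
          G : ℕ → ℚ
          G M = (R - R * η) + ((- g₁) * C M + (- g₂) * S M)

          F-sym : ∀ a b → F a b ≡ F b a
          F-sym a b = cong (λ t → R - (g₁ * C t + g₂ * S t)) (ℕ.+-comm (a ℕ./ q) (b ℕ./ q))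

          0≤F : ∀ a b → 0ℚ ≤ F a b
          0≤F a b = ≤⇒0≤- (dot≤ g₁ g₂ 0≤R g (a ℕ./ q ℕ.+ b ℕ./ q))

          G≤F : ∀ a b → G ((a ℕ.+ b) ℕ./ q) ≤ F a b
          G≤F a b with /-+ a b q
          ... | inj₁ eq rewrite eq = ≤-by (eq₁ R η g₁ g₂ (C i) (S i)) (0≤* 0≤R 0≤η)
            where
            i = a ℕ./ q ℕ.+ b ℕ./ q
            eq₁ : ∀ R η g₁ g₂ x y → (R - (g₁ * x + g₂ * y)) - ((R - R * η) + ((- g₁) * x + (- g₂) * y)) ≡ R * η
            eq₁ = solve-∀ ring
          ... | inj₂ eq rewrite eq = ≤-by (eq₁ R η g₁ g₂ (C i) (S i) (C (suc i)) (S (suc i)))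
                                          (≤⇒0≤- (dot-step≤ g₁ g₂ 0≤R g 0≤η step i))
            where
            i = a ℕ./ q ℕ.+ b ℕ./ q
            eq₁ : ∀ R η g₁ g₂ x y x′ y′ →
                  (R - (g₁ * x + g₂ * y)) - ((R - R * η) + ((- g₁) * x′ + (- g₂) * y′))
                  ≡ R * η - (g₁ * (x - x′) + g₂ * (y - y′))
            eq₁ = solve-∀ ring

          -- Over all ordered pairs the powers of `z` sum to `f²`, whose coordinates are
          -- `P * P - Q * Q` and `P * Q + P * Q`.
          square : squareSum F L ≡ l * (l * R) - (g₁ * (P * P - Q * Q) + g₂ * (P * Q + P * Q))
          square = begin
            squareSum F L
              ≡⟨ sumOver-cong L row ⟩
            sumOver (λ a → l * R + ((- (g₁ * P + g₂ * Q)) * C (a ℕ./ q) + (g₁ * Q - g₂ * P) * S (a ℕ./ q))) L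
              ≡⟨ sumOver-affine (l * R) (- (g₁ * P + g₂ * Q)) (g₁ * Q - g₂ * P) (λ a → C (a ℕ./ q)) (λ a → S (a ℕ./ q)) L ⟩
            l * (l * R) + ((- (g₁ * P + g₂ * Q)) * P + (g₁ * Q - g₂ * P) * Q)
              ≡⟨ eq (l * (l * R)) g₁ g₂ P Q ⟩
            l * (l * R) - (g₁ * (P * P - Q * Q) + g₂ * (P * Q + P * Q)) ∎
            where
            open ≡-Reasoning
            eq : ∀ t g₁ g₂ P Q → t + ((- (g₁ * P + g₂ * Q)) * P + (g₁ * Q - g₂ * P) * Q)
                 ≡ t - (g₁ * (P * P - Q * Q) + g₂ * (P * Q + P * Q))
            eq = solve-∀ ring
            eq₁ : ∀ R g₁ g₂ x y x′ y′ → R - (g₁ * (x * x′ - y * y′) + g₂ * (y * x′ + x * y′))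
                  ≡ R + ((- (g₁ * x + g₂ * y)) * x′ + (g₁ * y - g₂ * x) * y′)
            eq₁ = solve-∀ ring
            eq₂ : ∀ t g₁ g₂ x y P Q → t + ((- (g₁ * x + g₂ * y)) * P + (g₁ * y - g₂ * x) * Q)
                  ≡ t + ((- (g₁ * P + g₂ * Q)) * x + (g₁ * Q - g₂ * P) * y)
            eq₂ = solve-∀ ring
            row : ∀ a → sumOver (F a) L ≡ l * R + ((- (g₁ * P + g₂ * Q)) * C (a ℕ./ q) + (g₁ * Q - g₂ * P) * S (a ℕ./ q))
            row a = begin
              sumOver (F a) L
                ≡⟨ sumOver-cong L (λ b → trans
                     (cong₂ (λ x y → R - (g₁ * x + g₂ * y)) (C-+ (a ℕ./ q) (b ℕ./ q)) (S-+ (a ℕ./ q) (b ℕ./ q)))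
                     (eq₁ R g₁ g₂ x y (C (b ℕ./ q)) (S (b ℕ./ q)))) ⟩
              sumOver (λ b → R + ((- (g₁ * x + g₂ * y)) * C (b ℕ./ q) + (g₁ * y - g₂ * x) * S (b ℕ./ q))) L
                ≡⟨ sumOver-affine R (- (g₁ * x + g₂ * y)) (g₁ * y - g₂ * x) (λ b → C (b ℕ./ q)) (λ b → S (b ℕ./ q)) L ⟩
              l * R + ((- (g₁ * x + g₂ * y)) * P + (g₁ * y - g₂ * x) * Q)
                ≡⟨ eq₂ (l * R) g₁ g₂ x y P Q ⟩
              l * R + ((- (g₁ * P + g₂ * Q)) * x + (g₁ * Q - g₂ * P) * y) ∎
              where
              x = C (a ℕ./ q)
              y = S (a ℕ./ q)

          -- Every weight is at most `R + R`, by `dot≤` for the opposite direction; the resulting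
          -- error is only linear in the size of `L`.
          diagonal : sumOver (λ a → F a a) L ≤ l * (R + R)
          diagonal = subst (sumOver (λ a → F a a) L ≤_) (sumOver-const (R + R) L)
            (sumOver-mono L (λ {a} _ → ≤-by (eq R g₁ g₂ (C (i a)) (S (i a)))
              (≤⇒0≤- (dot≤ (- g₁) (- g₂) 0≤R (trans (eq′ g₁ g₂) g) (i a)))))
            where
            i : ℕ → ℕ
            i a = a ℕ./ q ℕ.+ a ℕ./ q
            eq : ∀ R g₁ g₂ x y → (R + R) - (R - (g₁ * x + g₂ * y)) ≡ R - ((- g₁) * x + (- g₂) * y)
            eq = solve-∀ ring
            eq′ : ∀ g₁ g₂ → (- g₁) * (- g₁) + (- g₂) * (- g₂) ≡ g₁ * g₁ + g₂ * g₂
            eq′ = solve-∀ ring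

        -- Each block number below `N` stands for `q` consecutive sums, so the left side is twice
        -- the total of `G` over the covered range. It is at most twice the pair sum, which is the
        -- square plus the diagonal.
        moment-inequality :
          (fromℕ q + fromℕ q) * (fromℕ N * (R - R * η) - (g₁ * sumTo N C + g₂ * sumTo N S))
          ≤ l * (l * R) - (g₁ * (P * P - Q * Q) + g₂ * (P * Q + P * Q)) + l * (R + R)
        moment-inequality = begin
          (fromℕ q + fromℕ q) * (n * (R - R * η) - (g₁ * sumTo N C + g₂ * sumTo N S))
            ≡⟨ eq (fromℕ q) (n * (R - R * η)) g₁ g₂ (sumTo N C) (sumTo N S) ⟩
          fromℕ q * total + fromℕ q * total
            ≡⟨ cong (λ t → fromℕ q * t + fromℕ q * t) (sumTo-affine (R - R * η) (- g₁) (- g₂) C S N) ⟨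
          fromℕ q * sumTo N G + fromℕ q * sumTo N G
            ≡⟨ cong₂ _+_ (sumTo-blocks q N G) (sumTo-blocks q N G) ⟨
          sumTo (N ℕ.* q) G/ + sumTo (N ℕ.* q) G/
            ≤⟨ +-mono-≤ counted counted ⟩
          pairSum F L + pairSum F L
            ≡⟨ pairSum-double F F-sym L ⟩
          squareSum F L + sumOver (λ a → F a a) L
            ≤⟨ +-mono-≤ (≤-reflexive square) diagonal ⟩
          l * (l * R) - (g₁ * (P * P - Q * Q) + g₂ * (P * Q + P * Q)) + l * (R + R) ∎
          where
          open ≤-Reasoning
          n = fromℕ N
          G/ : ℕ → ℚ
          G/ m = G (m ℕ./ q)
          total = n * (R - R * η) + ((- g₁) * sumTo N C + (- g₂) * sumTo N S)
          counted : sumTo (N ℕ.* q) G/ ≤ pairSum F L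
          counted = sumTo≤pairSum (N ℕ.* q) G/ F L cover F-sym 0≤F G≤F
          eq : ∀ q t g₁ g₂ x y → (q + q) * (t - (g₁ * x + g₂ * y))
               ≡ q * (t + ((- g₁) * x + (- g₂) * y)) + q * (t + ((- g₁) * x + (- g₂) * y))
          eq = solve-∀ ring

      module _ (k θ δ : ℚ) (0≤k : 0ℚ ≤ k) (l≤k : fromℕ (length L) ≤ k)
               (θk² : θ * (k * k) ≤ fromℕ q + fromℕ q) (δk² : k + k ≤ δ * (k * k)) where

        private
          -- `δ` absorbs the linear contribution of the diagonal.
          size : l * l + (l + l) ≤ (1ℚ + δ) * (k * k)
          size = begin
            l * l + (l + l)           ≤⟨ +-mono-≤ l²≤k² (+-mono-≤ l≤k l≤k) ⟩
            k * k + (k + k)           ≤⟨ +-monoʳ-≤ (k * k) δk² ⟩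
            k * k + δ * (k * k)       ≡⟨ eq δ (k * k) ⟩
            (1ℚ + δ) * (k * k)        ∎
            where
            open ≤-Reasoning
            l²≤k² : l * l ≤ k * k
            l²≤k² = ≤-trans (*-monoˡ l (0≤fromℕ (length L)) l≤k)
              (subst (_≤ k * k) (*-comm k l) (*-monoˡ k 0≤k l≤k))
            eq : ∀ δ x → x + δ * x ≡ (1ℚ + δ) * x
            eq = solve-∀ ring

        -- Moser's bound. With `g = f²` and `R = |f|²` the moment inequality leads to
        -- `2q R w ≤ R (1 + δ) k² - R²`, where `τ` bounds the modulus of the sum of the powers of
        -- `z`. Hence `R ≤ ε k²`, and Cauchy-Schwarz bounds the linear form in `f`.
        moment-bound : ∀ η τ u v ρ → 0ℚ ≤ η → (1ℚ - c) * (1ℚ - c) + s * s ≤ η * η →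
          0ℚ ≤ τ → sumTo N C * sumTo N C + sumTo N S * sumTo N S ≤ τ * τ →
          0ℚ ≤ fromℕ N * (1ℚ - η) - τ → 0ℚ ≤ (1ℚ + δ) - θ * (fromℕ N * (1ℚ - η) - τ) → 0ℚ ≤ ρ →
          (u * u + v * v) * ((1ℚ + δ) - θ * (fromℕ N * (1ℚ - η) - τ)) ≤ ρ * ρ →
          u * P + v * Q ≤ ρ * k
        moment-bound η τ u v ρ 0≤η step 0≤τ Στ 0≤w 0≤ε 0≤ρ uvρ = cauchy u v P Q (0≤* 0≤ρ 0≤k) (begin
          (u * u + v * v) * R                 ≤⟨ *-monoˡ (u * u + v * v) (0≤+ (0≤square u) (0≤square v)) R≤εk² ⟩
          (u * u + v * v) * (ε * (k * k))     ≡⟨ eq₁ (u * u + v * v) ε k ⟩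
          k * k * ((u * u + v * v) * ε)       ≤⟨ *-monoˡ (k * k) (0≤square k) uvρ ⟩
          k * k * (ρ * ρ)                     ≡⟨ eq₂ k ρ ⟩
          ρ * k * (ρ * k)                     ∎)
          where
          open ≤-Reasoning
          n = fromℕ N
          w = n * (1ℚ - η) - τ
          ε = (1ℚ + δ) - θ * w
          R = P * P + Q * Q
          g₁ = P * P - Q * Q
          g₂ = P * Q + P * Q
          2q = fromℕ q + fromℕ q
          σC = sumTo N C
          σS = sumTo N S
          eq₁ : ∀ x ε k → x * (ε * (k * k)) ≡ k * k * (x * ε)
          eq₁ = solve-∀ ring
          eq₂ : ∀ k ρ → k * k * (ρ * ρ) ≡ ρ * k * (ρ * k)
          eq₂ = solve-∀ ring
          0≤R : 0ℚ ≤ R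
          0≤R = 0≤+ (0≤square P) (0≤square Q)
          g : g₁ * g₁ + g₂ * g₂ ≡ R * R
          g = eq P Q
            where
            eq : ∀ P Q → (P * P - Q * Q) * (P * P - Q * Q) + (P * Q + P * Q) * (P * Q + P * Q)
                 ≡ (P * P + Q * Q) * (P * P + Q * Q)
            eq = solve-∀ ring
          g·σ : g₁ * σC + g₂ * σS ≤ R * τ
          g·σ = cauchy g₁ g₂ σC σS (0≤* 0≤R 0≤τ) (begin
            (g₁ * g₁ + g₂ * g₂) * (σC * σC + σS * σS) ≡⟨ cong (_* (σC * σC + σS * σS)) g ⟩
            R * R * (σC * σC + σS * σS)               ≤⟨ *-monoˡ (R * R) (0≤square R) Στ ⟩
            R * R * (τ * τ)                           ≡⟨ eq R τ ⟩
            R * τ * (R * τ)                           ∎)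
            where
            eq : ∀ R τ → R * R * (τ * τ) ≡ R * τ * (R * τ)
            eq = solve-∀ ring
          lower : 2q * (R * w) ≤ 2q * (n * (R - R * η) - (g₁ * σC + g₂ * σS))
          lower = *-monoˡ 2q (0≤+ (0≤fromℕ q) (0≤fromℕ q))
            (≤-by (eq n R η τ (g₁ * σC + g₂ * σS)) (≤⇒0≤- g·σ))
            where
            eq : ∀ n R η τ t → (n * (R - R * η) - t) - R * (n * (1ℚ - η) - τ) ≡ R * τ - t
            eq = solve-∀ ring
          upper : 2q * (R * w) ≤ R * ((1ℚ + δ) * (k * k)) - R * R
          upper = begin
            2q * (R * w)                                                      ≤⟨ lower ⟩
            2q * (n * (R - R * η) - (g₁ * σC + g₂ * σS))                      ≤⟨ moment-inequality g₁ g₂ R η 0≤R g 0≤η step ⟩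
            l * (l * R) - (g₁ * (P * P - Q * Q) + g₂ * (P * Q + P * Q)) + l * (R + R) ≡⟨ cong (λ t → l * (l * R) - t + l * (R + R)) g ⟩
            l * (l * R) - R * R + l * (R + R)                                ≡⟨ eq l R ⟩
            R * (l * l + (l + l)) - R * R                                    ≤⟨ +-monoˡ-≤ (- (R * R)) (*-monoˡ R 0≤R size) ⟩
            R * ((1ℚ + δ) * (k * k)) - R * R                                 ∎
            where
            eq : ∀ l R → l * (l * R) - R * R + l * (R + R) ≡ R * (l * l + (l + l)) - R * R
            eq = solve-∀ ring
          R≤εk² : R ≤ ε * (k * k)
          -- Since `w` is nonnegative, `2q` may be replaced by its lower bound `θ k²`; then one
          -- factor `R`, possibly zero, is cancelled.
          R≤εk² = x²≤xy⇒x≤y 0≤R (0≤* 0≤ε (0≤square k))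
            (≤-by (eq δ θ w (k * k) R 2q)
              (0≤+ (≤⇒0≤- upper) (0≤* (≤⇒0≤- θk²) (0≤* 0≤R 0≤w))))
            where
            eq : ∀ δ θ w x R 2q → R * (((1ℚ + δ) - θ * w) * x) - R * R
                 ≡ (R * ((1ℚ + δ) * x) - R * R - 2q * (R * w)) + (2q - θ * x) * (R * w)
            eq = solve-∀ ring

        -- The weight `1 + S`, from the direction `(0 , -1)` and `R = 1`: its total over the `N`
        -- blocks is large because the sines have a large sum, and this forces `P * Q` up.
        sine-bound : ∀ η μ → 0ℚ ≤ η → (1ℚ - c) * (1ℚ - c) + s * s ≤ η * η →
          0ℚ ≤ μ → μ ≤ fromℕ N * (1ℚ - η) + sumTo N S →
          θ * μ * (k * k) ≤ (1ℚ + δ) * (k * k) + (P * Q + P * Q)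
        sine-bound η μ 0≤η step 0≤μ μ≤ = begin
          θ * μ * (k * k)                                  ≡⟨ eq₁ θ μ (k * k) ⟩
          μ * (θ * (k * k))                                ≤⟨ *-monoˡ μ 0≤μ θk² ⟩
          μ * 2q                                            ≡⟨ *-comm μ 2q ⟩
          2q * μ                                            ≤⟨ *-monoˡ 2q (0≤+ (0≤fromℕ q) (0≤fromℕ q)) μ≤ ⟩
          2q * (n * (1ℚ - η) + sumTo N S)                   ≡⟨ eq₂ 2q n η (sumTo N C) (sumTo N S) ⟩
          2q * (n * (1ℚ - 1ℚ * η) - (0ℚ * sumTo N C + (- 1ℚ) * sumTo N S))
            ≤⟨ moment-inequality 0ℚ (- 1ℚ) 1ℚ η 0≤1 refl 0≤η step ⟩
          l * (l * 1ℚ) - (0ℚ * (P * P - Q * Q) + (- 1ℚ) * (P * Q + P * Q)) + l * (1ℚ + 1ℚ)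
            ≡⟨ eq₃ l (P * P - Q * Q) (P * Q + P * Q) ⟩
          l * l + (l + l) + (P * Q + P * Q)                ≤⟨ +-monoˡ-≤ (P * Q + P * Q) size ⟩
          (1ℚ + δ) * (k * k) + (P * Q + P * Q)             ∎
          where
          open ≤-Reasoning
          n = fromℕ N
          2q = fromℕ q + fromℕ q
          0≤1 : 0ℚ ≤ 1ℚ
          0≤1 = 0≤square 1ℚ
          eq₁ : ∀ θ μ x → θ * μ * x ≡ μ * (θ * x)
          eq₁ = solve-∀ ring
          eq₂ : ∀ 2q n η a b → 2q * (n * (1ℚ - η) + b) ≡ 2q * (n * (1ℚ - 1ℚ * η) - (0ℚ * a + (- 1ℚ) * b))
          eq₂ = solve-∀ ring
          eq₃ : ∀ l a b → l * (l * 1ℚ) - (0ℚ * a + (- 1ℚ) * b) + l * (1ℚ + 1ℚ) ≡ l * l + (l + l) + b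
          eq₃ = solve-∀ ring

  -- Exact integer evaluation of the rotations.

  -- After i steps of a rotation z whose coordinates have the common denominator K:
  -- x + i y = Kⁱ zⁱ and u + i v = Kⁱ Σ_{j<i} zʲ.
  record State : Set where
    constructor state
    field x y u v : ℤ
  open State

  start : State
  start = state (ℤ.+ 1) (ℤ.+ 0) (ℤ.+ 0) (ℤ.+ 0)

  rotate : (K a b : ℤ) → State → State
  rotate K a b (state x y u v) =
    state (a ℤ.* x ℤ.- b ℤ.* y) (b ℤ.* x ℤ.+ a ℤ.* y) (K ℤ.* (u ℤ.+ x)) (K ℤ.* (v ℤ.+ y))

  fromℤ-dot : ∀ κ p q a b x y → κ * p ≡ fromℤ x → κ * q ≡ fromℤ y →
              fromℤ (a ℤ.* x ℤ.+ b ℤ.* y) ≡ κ * (fromℤ a * p + fromℤ b * q)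
  fromℤ-dot κ p q a b x y hx hy = begin
    fromℤ (a ℤ.* x ℤ.+ b ℤ.* y)         ≡⟨ fromℤ-+ (a ℤ.* x) (b ℤ.* y) ⟩
    fromℤ (a ℤ.* x) + fromℤ (b ℤ.* y)   ≡⟨ cong₂ _+_ (fromℤ-* a x) (fromℤ-* b y) ⟩
    fromℤ a * fromℤ x + fromℤ b * fromℤ y ≡⟨ cong₂ (λ s t → fromℤ a * s + fromℤ b * t) hx hy ⟨
    fromℤ a * (κ * p) + fromℤ b * (κ * q) ≡⟨ eq κ (fromℤ a) p (fromℤ b) q ⟩
    κ * (fromℤ a * p + fromℤ b * q)     ∎
    where
    open ≡-Reasoning
    eq : ∀ κ a p b q → a * (κ * p) + b * (κ * q) ≡ κ * (a * p + b * q)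
    eq = solve-∀ ring

  module Scaled (c s : ℚ) (unit : c * c + s * s ≡ 1ℚ) (K a b : ℤ)
                (Kc : fromℤ K * c ≡ fromℤ a) (Ks : fromℤ K * s ≡ fromℤ b) where
    open Rotation c s unit

    -- `κ` stands for `Kⁱ` but is a parameter, so that the states of several rotations share one
    -- scale.
    record Tracks (i : ℕ) (κ : ℤ) (σ : State) : Set where
      field
        xC : fromℤ κ * C i ≡ fromℤ (x σ)
        yS : fromℤ κ * S i ≡ fromℤ (y σ)
        uC : fromℤ κ * sumTo i C ≡ fromℤ (u σ)
        vS : fromℤ κ * sumTo i S ≡ fromℤ (v σ)

    tracks-start : Tracks 0 (ℤ.+ 1) start
    tracks-start = record { xC = refl ; yS = refl ; uC = refl ; vS = refl }

    tracks-rotate : ∀ {i κ σ} → Tracks i κ σ → Tracks (suc i) (K ℤ.* κ) (rotate K a b σ)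
    tracks-rotate {i} {κ} {σ} t = record
      { xC = begin
          fromℤ (K ℤ.* κ) * (c * C i - s * S i)       ≡⟨ cong (_* (c * C i - s * S i)) (fromℤ-* K κ) ⟩
          fromℤ K * fromℤ κ * (c * C i - s * S i)     ≡⟨ eq₁ (fromℤ K) (fromℤ κ) c s (C i) (S i) ⟩
          fromℤ κ * (fromℤ K * c * C i + - (fromℤ K * s) * S i)
            ≡⟨ cong₂ (λ e f → fromℤ κ * (e * C i + f * S i)) Kc (trans (cong -_ Ks) (sym (fromℤ-neg b))) ⟩
          fromℤ κ * (fromℤ a * C i + fromℤ (ℤ.- b) * S i) ≡⟨ fromℤ-dot (fromℤ κ) (C i) (S i) a (ℤ.- b) (x σ) (y σ) (xC t) (yS t) ⟨
          fromℤ (a ℤ.* x σ ℤ.+ (ℤ.- b) ℤ.* y σ)       ≡⟨ cong (λ e → fromℤ (a ℤ.* x σ ℤ.+ e)) (ℤ.neg-distribˡ-* b (y σ)) ⟨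
          fromℤ (a ℤ.* x σ ℤ.- b ℤ.* y σ)             ∎
      ; yS = begin
          fromℤ (K ℤ.* κ) * (s * C i + c * S i)       ≡⟨ cong (_* (s * C i + c * S i)) (fromℤ-* K κ) ⟩
          fromℤ K * fromℤ κ * (s * C i + c * S i)     ≡⟨ eq₂ (fromℤ K) (fromℤ κ) c s (C i) (S i) ⟩
          fromℤ κ * (fromℤ K * s * C i + fromℤ K * c * S i)
            ≡⟨ cong₂ (λ e f → fromℤ κ * (e * C i + f * S i)) Ks Kc ⟩
          fromℤ κ * (fromℤ b * C i + fromℤ a * S i)   ≡⟨ fromℤ-dot (fromℤ κ) (C i) (S i) b a (x σ) (y σ) (xC t) (yS t) ⟨
          fromℤ (b ℤ.* x σ ℤ.+ a ℤ.* y σ)             ∎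
      ; uC = accumulate (sumTo i C) (C i) (u σ) (x σ) (uC t) (xC t)
      ; vS = accumulate (sumTo i S) (S i) (v σ) (y σ) (vS t) (yS t)
      }
      where
      open ≡-Reasoning
      open Tracks
      eq₁ : ∀ K κ c s x y → K * κ * (c * x - s * y) ≡ κ * (K * c * x + - (K * s) * y)
      eq₁ = solve-∀ ring
      eq₂ : ∀ K κ c s x y → K * κ * (s * x + c * y) ≡ κ * (K * s * x + K * c * y)
      eq₂ = solve-∀ ring
      eq₃ : ∀ K κ p q → K * κ * (p + q) ≡ K * (κ * p + κ * q)
      eq₃ = solve-∀ ring
      accumulate : ∀ p q w z → fromℤ κ * p ≡ fromℤ w → fromℤ κ * q ≡ fromℤ z →
                   fromℤ (K ℤ.* κ) * (p + q) ≡ fromℤ (K ℤ.* (w ℤ.+ z))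
      accumulate p q w z hp hq = begin
        fromℤ (K ℤ.* κ) * (p + q)                 ≡⟨ cong (_* (p + q)) (fromℤ-* K κ) ⟩
        fromℤ K * fromℤ κ * (p + q)               ≡⟨ eq₃ (fromℤ K) (fromℤ κ) p q ⟩
        fromℤ K * (fromℤ κ * p + fromℤ κ * q)     ≡⟨ cong₂ (λ e f → fromℤ K * (e + f)) hp hq ⟩
        fromℤ K * (fromℤ w + fromℤ z)             ≡⟨ cong (fromℤ K *_) (fromℤ-+ w z) ⟨
        fromℤ K * fromℤ (w ℤ.+ z)                 ≡⟨ fromℤ-* K (w ℤ.+ z) ⟨
        fromℤ (K ℤ.* (w ℤ.+ z))                   ∎

  -- Boolean tests along an orbit.

  module Streaming {A : Set} (step : A → A) (good final : A → Bool) where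

    iterate : A → ℕ → A
    iterate s zero    = s
    iterate s (suc i) = step (iterate s i)

    -- Tests the states in one forward pass, each obtained from its predecessor; `iterate`, with the
    -- step outermost, suits induction on the index.
    run : ℕ → A → Bool
    run zero    s = final s
    run (suc n) s = good s ∧ run n (step s)

    iterate-step : ∀ s i → iterate (step s) i ≡ step (iterate s i)
    iterate-step s zero    = refl
    iterate-step s (suc i) = cong step (iterate-step s i)

    ∧-true : ∀ {p q} → p ∧ q ≡ true → p ≡ true × q ≡ true
    ∧-true {true} eq = refl , eq

    run-good : ∀ n s → run n s ≡ true → ∀ i → i ℕ.< n → good (iterate s i) ≡ true
    run-good (suc n) s eq zero    _         = proj₁ (∧-true eq)
    run-good (suc n) s eq (suc i) (ℕ.s≤s p) =
      trans (cong good (sym (iterate-step s i))) (run-good n (step s) (proj₂ (∧-true {good s} eq)) i p)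

    run-final : ∀ n s → run n s ≡ true → final (iterate s n) ≡ true
    run-final zero    s eq = eq
    run-final (suc n) s eq =
      trans (cong final (sym (iterate-step s n))) (run-final n (step s) (proj₂ (∧-true {good s} eq)))

  record Turn (K : ℤ) : Set where
    field
      c s  : ℚ
      unit : c * c + s * s ≡ 1ℚ
      a b  : ℤ
      Kc   : fromℤ K * c ≡ fromℤ a
      Ks   : fromℤ K * s ≡ fromℤ b
    open Rotation c s unit public
    open Scaled c s unit K a b Kc Ks public

  -- The trigonometric certificate.

  -- The trigonometric polynomial was found by linear programming: with everything scaled by M,
  --   -B ≤ M (C₁ + S₁) ≤ B₀ + Σ_m (u_m C_m + v_m S_m),  m = 2, 4, 6,
  -- at the powers i < N. Moser's bound gives Re (conj (u_m + i v_m) f_m) ≤ ρ_m k, and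
  -- B = B₀ + ρ₂ + ρ₄ + ρ₆. Further η_m = 2/t_m with t_m as at the turns below,
  -- μ₀ ≤ Σ_{j<N} S₁ ≈ 2N/π, μ ≤ N (1 - η₁) + μ₀, and θ k² ≤ 2q, where θ N = 0.9577 is slightly
  -- less than 2 · 0.4789.
  N : ℕ
  N = 1998

  M u₂ v₂ u₄ v₄ u₆ v₆ B₀ B ρ₂ ρ₄ ρ₆ μ₀ μ : ℤ
  M  = ℤ.+ 1000
  u₂ = ℤ.- ℤ.+ 29
  v₂ = ℤ.+ 629
  u₄ = ℤ.+ 115
  v₄ = ℤ.+ 50
  u₆ = ℤ.+ 28
  v₆ = ℤ.- ℤ.+ 15
  B₀ = ℤ.+ 888
  B  = ℤ.+ 1059
  ρ₂ = ℤ.+ 135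
  ρ₄ = ℤ.+ 28
  ρ₆ = ℤ.+ 8
  μ₀ = ℤ.+ 1271
  μ  = ℤ.+ 3265

  η₁ η₂ η₄ η₆ θ δ : ℚ
  η₁ = ℤ.+ 1 / 636
  η₂ = ℤ.+ 1 / 318
  η₄ = ℤ.+ 1 / 159
  η₆ = ℤ.+ 1 / 106
  θ  = ℤ.+ 9577 / 19980000
  δ  = ℤ.+ 1 / 10000

  record States : Set where
    constructor states
    field
      κ           : ℤ
      σ₁ σ₂ σ₄ σ₆ : State

  initial : States
  initial = states (ℤ.+ 1) start start start start

  dot : ℤ → ℤ → State → ℤ
  dot a b (state x y u v) = a ℤ.* x ℤ.+ b ℤ.* y

  -- A geometric sum has modulus `|1 - zᴺ| / |1 - z|`. For the turns 2, 4, 6 the power `zᴺ` is so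
  -- close to 1 that this is at most 1, the value later taken for `τ`.
  cancels : ℤ → State → Bool
  cancels κ (state x y u v) = u ℤ.* u ℤ.+ v ℤ.* v ℤ.≤ᵇ κ ℤ.* κ

  ≡true⇒T : ∀ {b} → b ≡ true → T b
  ≡true⇒T refl = tt

  ≤ᵇ-sound : ∀ {i j} → (i ℤ.≤ᵇ j) ≡ true → fromℤ i ≤ fromℤ j
  ≤ᵇ-sound eq = fromℤ-≤ (ℤ.≤ᵇ⇒≤ (≡true⇒T eq))

  cancels-sound : ∀ κ σ p q → 0ℚ < fromℤ κ → fromℤ κ * p ≡ fromℤ (State.u σ) → fromℤ κ * q ≡ fromℤ (State.v σ) →
                  cancels κ σ ≡ true → p * p + q * q ≤ 1ℚ * 1ℚ
  cancels-sound κ (state x y u v) p q 0<κ hp hq small =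
    *-cancelˡ-≤-pos (fromℤ κ * fromℤ κ) {{positive (0<* 0<κ 0<κ)}} (begin
      fromℤ κ * fromℤ κ * (p * p + q * q)                   ≡⟨ eq (fromℤ κ) p q ⟩
      fromℤ κ * p * (fromℤ κ * p) + fromℤ κ * q * (fromℤ κ * q) ≡⟨ cong₂ (λ a b → a * a + b * b) hp hq ⟩
      fromℤ u * fromℤ u + fromℤ v * fromℤ v                 ≡⟨ cong₂ _+_ (fromℤ-* u u) (fromℤ-* v v) ⟨
      fromℤ (u ℤ.* u) + fromℤ (v ℤ.* v)                     ≡⟨ fromℤ-+ (u ℤ.* u) (v ℤ.* v) ⟨
      fromℤ (u ℤ.* u ℤ.+ v ℤ.* v)                           ≤⟨ ≤ᵇ-sound small ⟩
      fromℤ (κ ℤ.* κ)                                       ≡⟨ fromℤ-* κ κ ⟩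
      fromℤ κ * fromℤ κ                                     ≡⟨ *-identityʳ (fromℤ κ * fromℤ κ) ⟨
      fromℤ κ * fromℤ κ * (1ℚ * 1ℚ)                         ∎)
    where
    open ≤-Reasoning
    eq : ∀ κ p q → κ * κ * (p * p + q * q) ≡ κ * p * (κ * p) + κ * q * (κ * q)
    eq = solve-∀ ring

  -- K and the turns stay abstract here: were K a literal, conversion checking would unfold
  -- products such as K ℤ.* κ one unit at a time.
  module Certificate (K : ℤ) (0<K : 0ℚ < fromℤ K) (turn₁ turn₂ turn₄ turn₆ : Turn K) where

    module T₁ = Turn turn₁
    module T₂ = Turn turn₂
    module T₄ = Turn turn₄
    module T₆ = Turn turn₆

    advance : States → States
    advance (states κ σ₁ σ₂ σ₄ σ₆) = states (K ℤ.* κ)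
      (rotate K T₁.a T₁.b σ₁) (rotate K T₂.a T₂.b σ₂) (rotate K T₄.a T₄.b σ₄) (rotate K T₆.a T₆.b σ₆)

    upper lower : States → Bool
    upper (states κ σ₁ σ₂ σ₄ σ₆) =
      dot M M σ₁ ℤ.≤ᵇ B₀ ℤ.* κ ℤ.+ (dot u₂ v₂ σ₂ ℤ.+ (dot u₄ v₄ σ₄ ℤ.+ dot u₆ v₆ σ₆))
    lower (states κ σ₁ σ₂ σ₄ σ₆) = dot (ℤ.- M) (ℤ.- M) σ₁ ℤ.≤ᵇ B ℤ.* κ

    good final : States → Bool
    good σ = upper σ ∧ lower σ
    final (states κ (state x y u v) σ₂ σ₄ σ₆) =
      (μ₀ ℤ.* κ ℤ.≤ᵇ v) ∧ (cancels κ σ₂ ∧ (cancels κ σ₄ ∧ cancels κ σ₆))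

    open Streaming advance good final public

    at : ℕ → States
    at = iterate initial

    record Tracked (i : ℕ) (σ : States) : Set where
      open States σ
      field
        0<κ : 0ℚ < fromℤ κ
        t₁  : T₁.Tracks i κ σ₁
        t₂  : T₂.Tracks i κ σ₂
        t₄  : T₄.Tracks i κ σ₄
        t₆  : T₆.Tracks i κ σ₆

    tracked : ∀ i → Tracked i (at i)
    tracked zero    = record
      { 0<κ = from-yes (0ℚ <? fromℤ (ℤ.+ 1))
      ; t₁ = T₁.tracks-start ; t₂ = T₂.tracks-start ; t₄ = T₄.tracks-start ; t₆ = T₆.tracks-start }
    tracked (suc i) = record
      { 0<κ = subst (0ℚ <_) (sym (fromℤ-* K (States.κ (at i)))) (0<* 0<K 0<κ)
      ; t₁ = T₁.tracks-rotate t₁ ; t₂ = T₂.tracks-rotate t₂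
      ; t₄ = T₄.tracks-rotate t₄ ; t₆ = T₆.tracks-rotate t₆ }
      where open Tracked (tracked i)

    module _ (checked : run N initial ≡ true) where

      -- The test at step `i` compares integers scaled by `κ`; `Tracked` translates them, and
      -- dividing by the positive `κ` leaves the rational inequality.
      certificate-upper : ∀ i → i ℕ.< N →
        fromℤ M * T₁.C i + fromℤ M * T₁.S i
        ≤ fromℤ B₀ + ((fromℤ u₂ * T₂.C i + fromℤ v₂ * T₂.S i)
          + ((fromℤ u₄ * T₄.C i + fromℤ v₄ * T₄.S i) + (fromℤ u₆ * T₆.C i + fromℤ v₆ * T₆.S i)))
      certificate-upper i i<N = *-cancelˡ-≤-pos (fromℤ κ) {{positive 0<κ}} (begin
        fromℤ κ * w₁                                   ≡⟨ spec₁ ⟨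
        fromℤ (dot M M σ₁)                             ≤⟨ ≤ᵇ-sound (proj₁ (∧-true {upper (at i)} (run-good N initial checked i i<N))) ⟩
        fromℤ (B₀ ℤ.* κ ℤ.+ (dot u₂ v₂ σ₂ ℤ.+ (dot u₄ v₄ σ₄ ℤ.+ dot u₆ v₆ σ₆)))
          ≡⟨ trans (fromℤ-+ (B₀ ℤ.* κ) (dot u₂ v₂ σ₂ ℤ.+ (dot u₄ v₄ σ₄ ℤ.+ dot u₆ v₆ σ₆)))
               (cong₂ _+_ (fromℤ-* B₀ κ)
                 (trans (fromℤ-+ (dot u₂ v₂ σ₂) (dot u₄ v₄ σ₄ ℤ.+ dot u₆ v₆ σ₆))
                   (cong (fromℤ (dot u₂ v₂ σ₂) +_) (fromℤ-+ (dot u₄ v₄ σ₄) (dot u₆ v₆ σ₆))))) ⟩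
        fromℤ B₀ * fromℤ κ + (fromℤ (dot u₂ v₂ σ₂) + (fromℤ (dot u₄ v₄ σ₄) + fromℤ (dot u₆ v₆ σ₆)))
          ≡⟨ cong (fromℤ B₀ * fromℤ κ +_) (cong₂ _+_ spec₂ (cong₂ _+_ spec₄ spec₆)) ⟩
        fromℤ B₀ * fromℤ κ + (fromℤ κ * w₂ + (fromℤ κ * w₄ + fromℤ κ * w₆)) ≡⟨ eq (fromℤ B₀) (fromℤ κ) w₂ w₄ w₆ ⟩
        fromℤ κ * (fromℤ B₀ + (w₂ + (w₄ + w₆)))        ∎)
        where
        open ≤-Reasoning
        open Tracked (tracked i)
        open States (at i)
        w₁ = fromℤ M * T₁.C i + fromℤ M * T₁.S i
        w₂ = fromℤ u₂ * T₂.C i + fromℤ v₂ * T₂.S i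
        w₄ = fromℤ u₄ * T₄.C i + fromℤ v₄ * T₄.S i
        w₆ = fromℤ u₆ * T₆.C i + fromℤ v₆ * T₆.S i
        spec₁ : fromℤ (dot M M σ₁) ≡ fromℤ κ * w₁
        spec₁ = fromℤ-dot (fromℤ κ) (T₁.C i) (T₁.S i) M M (State.x σ₁) (State.y σ₁) (T₁.Tracks.xC t₁) (T₁.Tracks.yS t₁)
        spec₂ : fromℤ (dot u₂ v₂ σ₂) ≡ fromℤ κ * w₂
        spec₂ = fromℤ-dot (fromℤ κ) (T₂.C i) (T₂.S i) u₂ v₂ (State.x σ₂) (State.y σ₂) (T₂.Tracks.xC t₂) (T₂.Tracks.yS t₂)
        spec₄ : fromℤ (dot u₄ v₄ σ₄) ≡ fromℤ κ * w₄
        spec₄ = fromℤ-dot (fromℤ κ) (T₄.C i) (T₄.S i) u₄ v₄ (State.x σ₄) (State.y σ₄) (T₄.Tracks.xC t₄) (T₄.Tracks.yS t₄)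
        spec₆ : fromℤ (dot u₆ v₆ σ₆) ≡ fromℤ κ * w₆
        spec₆ = fromℤ-dot (fromℤ κ) (T₆.C i) (T₆.S i) u₆ v₆ (State.x σ₆) (State.y σ₆) (T₆.Tracks.xC t₆) (T₆.Tracks.yS t₆)
        eq : ∀ b κ x y z → b * κ + (κ * x + (κ * y + κ * z)) ≡ κ * (b + (x + (y + z)))
        eq = solve-∀ ring

      certificate-lower : ∀ i → i ℕ.< N →
        fromℤ (ℤ.- M) * T₁.C i + fromℤ (ℤ.- M) * T₁.S i ≤ fromℤ B
      certificate-lower i i<N = *-cancelˡ-≤-pos (fromℤ κ) {{positive 0<κ}} (begin
        fromℤ κ * (fromℤ (ℤ.- M) * T₁.C i + fromℤ (ℤ.- M) * T₁.S i)
          ≡⟨ fromℤ-dot (fromℤ κ) (T₁.C i) (T₁.S i) (ℤ.- M) (ℤ.- M) (State.x σ₁) (State.y σ₁) (T₁.Tracks.xC t₁) (T₁.Tracks.yS t₁) ⟨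
        fromℤ (dot (ℤ.- M) (ℤ.- M) σ₁)  ≤⟨ ≤ᵇ-sound (proj₂ (∧-true {upper (at i)} (run-good N initial checked i i<N))) ⟩
        fromℤ (B ℤ.* κ)                 ≡⟨ fromℤ-* B κ ⟩
        fromℤ B * fromℤ κ               ≡⟨ *-comm (fromℤ B) (fromℤ κ) ⟩
        fromℤ κ * fromℤ B               ∎)
        where
        open ≤-Reasoning
        open Tracked (tracked i)
        open States (at i)

      private
        σN : States
        σN = at N
        finals : final σN ≡ true
        finals = run-final N initial checked
        open Tracked (tracked N)
        open States σN
        f₁ = ∧-true {μ₀ ℤ.* κ ℤ.≤ᵇ State.v σ₁} finals
        f₂ = ∧-true {cancels κ σ₂} (proj₂ f₁)
        f₄ = ∧-true {cancels κ σ₄} (proj₂ f₂)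

      sum-sine : fromℤ μ₀ ≤ sumTo N T₁.S
      sum-sine = *-cancelˡ-≤-pos (fromℤ κ) {{positive 0<κ}} (begin
        fromℤ κ * fromℤ μ₀         ≡⟨ *-comm (fromℤ κ) (fromℤ μ₀) ⟩
        fromℤ μ₀ * fromℤ κ         ≡⟨ fromℤ-* μ₀ κ ⟨
        fromℤ (μ₀ ℤ.* κ)           ≤⟨ ≤ᵇ-sound (proj₁ f₁) ⟩
        fromℤ (State.v σ₁)         ≡⟨ T₁.Tracks.vS t₁ ⟨
        fromℤ κ * sumTo N T₁.S     ∎)
        where open ≤-Reasoning

      sum₂ : sumTo N T₂.C * sumTo N T₂.C + sumTo N T₂.S * sumTo N T₂.S ≤ 1ℚ * 1ℚ
      sum₂ = cancels-sound κ σ₂ (sumTo N T₂.C) (sumTo N T₂.S) 0<κ (T₂.Tracks.uC t₂) (T₂.Tracks.vS t₂) (proj₁ f₂)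
      sum₄ : sumTo N T₄.C * sumTo N T₄.C + sumTo N T₄.S * sumTo N T₄.S ≤ 1ℚ * 1ℚ
      sum₄ = cancels-sound κ σ₄ (sumTo N T₄.C) (sumTo N T₄.S) 0<κ (T₄.Tracks.uC t₄) (T₄.Tracks.vS t₄) (proj₁ f₄)
      sum₆ : sumTo N T₆.C * sumTo N T₆.C + sumTo N T₆.S * sumTo N T₆.S ≤ 1ℚ * 1ℚ
      sum₆ = cancels-sound κ σ₆ (sumTo N T₆.C) (sumTo N T₆.S) 0<κ (T₆.Tracks.uC t₆) (T₆.Tracks.vS t₆) (proj₂ f₄)

      -- Combining the moment bounds.

      module Contradiction
        (step₁ : (1ℚ - T₁.c) * (1ℚ - T₁.c) + T₁.s * T₁.s ≤ η₁ * η₁)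
        (step₂ : (1ℚ - T₂.c) * (1ℚ - T₂.c) + T₂.s * T₂.s ≤ η₂ * η₂)
        (step₄ : (1ℚ - T₄.c) * (1ℚ - T₄.c) + T₄.s * T₄.s ≤ η₄ * η₄)
        (step₆ : (1ℚ - T₆.c) * (1ℚ - T₆.c) + T₆.s * T₆.s ≤ η₆ * η₆)
        (q : ℕ) .{{_ : ℕ.NonZero q}} (L : List ℕ) (L<Nq : ∀ {a} → a ∈ L → a ℕ.< N ℕ.* q)
        (cover : ∀ m → m ℕ.< N ℕ.* q → ∃[ a ] ∃[ b ] (a ∈ L × b ∈ L × a ℕ.+ b ≡ m))
        (k : ℚ) (0<k : 0ℚ < k) (l≤k : fromℕ (length L) ≤ k)
        (θk² : θ * (k * k) ≤ fromℕ q + fromℕ q) (δk² : k + k ≤ δ * (k * k)) where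

        private
          0≤k : 0ℚ ≤ k
          0≤k = <⇒≤ 0<k
          P₁ = T₁.P q N L cover
          Q₁ = T₁.Q q N L cover
          P₂ = T₂.P q N L cover
          Q₂ = T₂.Q q N L cover
          P₄ = T₄.P q N L cover
          Q₄ = T₄.Q q N L cover
          P₆ = T₆.P q N L cover
          Q₆ = T₆.Q q N L cover
          z = fromℤ M * P₁ + fromℤ M * Q₁

        -- The closed inequalities are decided by evaluation. Here `ε` is about 0.046, so the
        -- modulus of `P₂ + i Q₂` is at most about 0.2143 `k`; the coefficient vector has length
        -- just under 630, and the product stays below `ρ₂ = 135`.
        bound₂ : fromℤ u₂ * P₂ + fromℤ v₂ * Q₂ ≤ fromℤ ρ₂ * k
        bound₂ = T₂.moment-bound q N L cover k θ δ 0≤k l≤k θk² δk² η₂ 1ℚ (fromℤ u₂) (fromℤ v₂) (fromℤ ρ₂)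
          (from-yes (0ℚ ≤? η₂)) step₂ (from-yes (0ℚ ≤? 1ℚ)) sum₂
          (from-yes (0ℚ ≤? fromℕ N * (1ℚ - η₂) - 1ℚ)) (from-yes (0ℚ ≤? (1ℚ + δ) - θ * (fromℕ N * (1ℚ - η₂) - 1ℚ)))
          (from-yes (0ℚ ≤? fromℤ ρ₂))
          (from-yes ((fromℤ u₂ * fromℤ u₂ + fromℤ v₂ * fromℤ v₂) * ((1ℚ + δ) - θ * (fromℕ N * (1ℚ - η₂) - 1ℚ)) ≤? fromℤ ρ₂ * fromℤ ρ₂))

        bound₄ : fromℤ u₄ * P₄ + fromℤ v₄ * Q₄ ≤ fromℤ ρ₄ * k
        bound₄ = T₄.moment-bound q N L cover k θ δ 0≤k l≤k θk² δk² η₄ 1ℚ (fromℤ u₄) (fromℤ v₄) (fromℤ ρ₄)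
          (from-yes (0ℚ ≤? η₄)) step₄ (from-yes (0ℚ ≤? 1ℚ)) sum₄
          (from-yes (0ℚ ≤? fromℕ N * (1ℚ - η₄) - 1ℚ)) (from-yes (0ℚ ≤? (1ℚ + δ) - θ * (fromℕ N * (1ℚ - η₄) - 1ℚ)))
          (from-yes (0ℚ ≤? fromℤ ρ₄))
          (from-yes ((fromℤ u₄ * fromℤ u₄ + fromℤ v₄ * fromℤ v₄) * ((1ℚ + δ) - θ * (fromℕ N * (1ℚ - η₄) - 1ℚ)) ≤? fromℤ ρ₄ * fromℤ ρ₄))

        bound₆ : fromℤ u₆ * P₆ + fromℤ v₆ * Q₆ ≤ fromℤ ρ₆ * k
        bound₆ = T₆.moment-bound q N L cover k θ δ 0≤k l≤k θk² δk² η₆ 1ℚ (fromℤ u₆) (fromℤ v₆) (fromℤ ρ₆)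
          (from-yes (0ℚ ≤? η₆)) step₆ (from-yes (0ℚ ≤? 1ℚ)) sum₆
          (from-yes (0ℚ ≤? fromℕ N * (1ℚ - η₆) - 1ℚ)) (from-yes (0ℚ ≤? (1ℚ + δ) - θ * (fromℕ N * (1ℚ - η₆) - 1ℚ)))
          (from-yes (0ℚ ≤? fromℤ ρ₆))
          (from-yes ((fromℤ u₆ * fromℤ u₆ + fromℤ v₆ * fromℤ v₆) * ((1ℚ + δ) - θ * (fromℕ N * (1ℚ - η₆) - 1ℚ)) ≤? fromℤ ρ₆ * fromℤ ρ₆))

        bound₁ : θ * fromℤ μ * (k * k) ≤ (1ℚ + δ) * (k * k) + (P₁ * Q₁ + P₁ * Q₁)
        bound₁ = T₁.sine-bound q N L cover k θ δ 0≤k l≤k θk² δk² η₁ (fromℤ μ)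
          (from-yes (0ℚ ≤? η₁)) step₁ (from-yes (0ℚ ≤? fromℤ μ))
          (≤-trans (from-yes (fromℤ μ ≤? fromℕ N * (1ℚ - η₁) + fromℤ μ₀))
            (+-monoʳ-≤ (fromℕ N * (1ℚ - η₁)) sum-sine))

        private
          -- The certificate is tested only at powers `i < N`; here the restriction of `L` to
          -- numbers below `N q` enters.
          block< : ∀ {a} → a ∈ L → a ℕ./ q ℕ.< N
          block< a∈L = ℕ.m<n*o⇒m/o<n (L<Nq a∈L)

        z≤ : z ≤ fromℤ B * k
        z≤ = begin
          z ≡⟨ sumOver-linear (fromℤ M) (fromℤ M) (λ a → T₁.C (a ℕ./ q)) (λ a → T₁.S (a ℕ./ q)) L ⟨
          sumOver (λ a → fromℤ M * T₁.C (a ℕ./ q) + fromℤ M * T₁.S (a ℕ./ q)) L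
            ≤⟨ sumOver-mono L (λ {a} a∈L → certificate-upper (a ℕ./ q) (block< a∈L)) ⟩
          sumOver (λ a → fromℤ B₀ + (w₂ a + (w₄ a + w₆ a))) L
            ≡⟨ trans (sumOver-+ (λ _ → fromℤ B₀) (λ a → w₂ a + (w₄ a + w₆ a)) L)
                (cong₂ _+_ (sumOver-const (fromℤ B₀) L)
                  (trans (sumOver-+ w₂ (λ a → w₄ a + w₆ a) L)
                    (cong₂ _+_ (sumOver-linear (fromℤ u₂) (fromℤ v₂) (λ a → T₂.C (a ℕ./ q)) (λ a → T₂.S (a ℕ./ q)) L)
                      (trans (sumOver-+ w₄ w₆ L) (cong₂ _+_
                        (sumOver-linear (fromℤ u₄) (fromℤ v₄) (λ a → T₄.C (a ℕ./ q)) (λ a → T₄.S (a ℕ./ q)) L)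
                        (sumOver-linear (fromℤ u₆) (fromℤ v₆) (λ a → T₆.C (a ℕ./ q)) (λ a → T₆.S (a ℕ./ q)) L)))))) ⟩
          fromℕ (length L) * fromℤ B₀ + ((fromℤ u₂ * P₂ + fromℤ v₂ * Q₂) + ((fromℤ u₄ * P₄ + fromℤ v₄ * Q₄) + (fromℤ u₆ * P₆ + fromℤ v₆ * Q₆)))
            ≤⟨ +-mono-≤ (*-monoʳ (fromℤ B₀) (from-yes (0ℚ ≤? fromℤ B₀)) l≤k) (+-mono-≤ bound₂ (+-mono-≤ bound₄ bound₆)) ⟩
          k * fromℤ B₀ + (fromℤ ρ₂ * k + (fromℤ ρ₄ * k + fromℤ ρ₆ * k))
            ≡⟨ eq k (fromℤ B₀) (fromℤ ρ₂) (fromℤ ρ₄) (fromℤ ρ₆) ⟩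
          -- By evaluation `888 + 135 + 28 + 8 = 1059`, which is `B`.
          (fromℤ B₀ + (fromℤ ρ₂ + (fromℤ ρ₄ + fromℤ ρ₆))) * k ∎
          where
          open ≤-Reasoning
          w₂ w₄ w₆ : ℕ → ℚ
          w₂ a = fromℤ u₂ * T₂.C (a ℕ./ q) + fromℤ v₂ * T₂.S (a ℕ./ q)
          w₄ a = fromℤ u₄ * T₄.C (a ℕ./ q) + fromℤ v₄ * T₄.S (a ℕ./ q)
          w₆ a = fromℤ u₆ * T₆.C (a ℕ./ q) + fromℤ v₆ * T₆.S (a ℕ./ q)
          eq : ∀ k b r s t → k * b + (r * k + (s * k + t * k)) ≡ (b + (r + (s + t))) * k
          eq = solve-∀ ring

        -- Together with `z≤` this gives `z² ≤ B² k²`.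
        -z≤ : - z ≤ fromℤ B * k
        -z≤ = begin
          - z ≡⟨ eq (fromℤ M) P₁ Q₁ ⟩
          (- fromℤ M) * P₁ + (- fromℤ M) * Q₁
            ≡⟨ sumOver-linear (fromℤ (ℤ.- M)) (fromℤ (ℤ.- M)) (λ a → T₁.C (a ℕ./ q)) (λ a → T₁.S (a ℕ./ q)) L ⟨
          sumOver (λ a → fromℤ (ℤ.- M) * T₁.C (a ℕ./ q) + fromℤ (ℤ.- M) * T₁.S (a ℕ./ q)) L
            ≤⟨ sumOver-mono L (λ {a} a∈L → certificate-lower (a ℕ./ q) (block< a∈L)) ⟩
          sumOver (λ _ → fromℤ B) L       ≡⟨ sumOver-const (fromℤ B) L ⟩
          fromℕ (length L) * fromℤ B      ≤⟨ *-monoʳ (fromℤ B) (from-yes (0ℚ ≤? fromℤ B)) l≤k ⟩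
          k * fromℤ B                     ≡⟨ *-comm k (fromℤ B) ⟩
          fromℤ B * k                     ∎
          where
          open ≤-Reasoning
          eq : ∀ m p q → - (m * p + m * q) ≡ (- m) * p + (- m) * q
          eq = solve-∀ ring

        -- From `z² = M² (P₁ + Q₁)² ≥ 4 M² P₁ Q₁`, the upper bound on `z²` and the lower bound on
        -- `P₁ Q₁` it follows that `gap * k² ≤ 0`, whereas `gap` is about 8340. The three summands
        -- in `eq` are the slacks of these inequalities.
        contradictory : ⊥
        contradictory = <-irrefl refl (<-≤-trans
          (0<* (from-yes (0ℚ <? gap)) (0<* 0<k 0<k))
          (≤-by (eq (fromℤ M) (fromℤ B) θ (fromℤ μ) δ k P₁ Q₁)
            (0≤+ (0≤+ (0≤* (≤⇒0≤- z≤) (subst (0ℚ ≤_) (eq′ (fromℤ B * k) z) (≤⇒0≤- -z≤)))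
                      (0≤* (from-yes (0ℚ ≤? 2M²)) (≤⇒0≤- bound₁)))
                 (0≤square (fromℤ M * (P₁ - Q₁))))))
          where
          2M² gap : ℚ
          2M² = fromℤ M * fromℤ M + fromℤ M * fromℤ M
          gap = 2M² * (θ * fromℤ μ - (1ℚ + δ)) - fromℤ B * fromℤ B
          eq′ : ∀ x y → x - (- y) ≡ x + y
          eq′ = solve-∀ ring
          eq : ∀ m b θ μ δ k p q → 0ℚ - ((m * m + m * m) * (θ * μ - (1ℚ + δ)) - b * b) * (k * k)
               ≡ (b * k - (m * p + m * q)) * (b * k + (m * p + m * q))
                 + (m * m + m * m) * ((1ℚ + δ) * (k * k) + (p * q + p * q) - θ * μ * (k * k))
                 + m * (p - q) * (m * (p - q))
          eq = solve-∀ ring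

  -- The four rational rotations.

  -- turn m is (t + i)²/(t² + 1), of angle 2 arctan (1/t) ≈ π m / N, for t = 1272, 636, 318, 212.
  D₁ D₂ D₄ D₆ K : ℤ
  D₁ = ℤ.+ 1617985
  D₂ = ℤ.+ 404497
  D₄ = ℤ.+ 101125
  D₆ = ℤ.+ 44945
  K = D₁ ℤ.* D₂ ℤ.* D₄ ℤ.* D₆

  turn₁ turn₂ turn₄ turn₆ : Turn K
  turn₁ = record
    { c = ℤ.+ 1617983 / 1617985 ; s = ℤ.+ 2544 / 1617985 ; unit = refl
    ; a = ℤ.+ 1617983 ℤ.* D₂ ℤ.* D₄ ℤ.* D₆ ; b = ℤ.+ 2544 ℤ.* D₂ ℤ.* D₄ ℤ.* D₆ ; Kc = refl ; Ks = refl }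
  turn₂ = record
    { c = ℤ.+ 404495 / 404497 ; s = ℤ.+ 1272 / 404497 ; unit = refl
    ; a = D₁ ℤ.* ℤ.+ 404495 ℤ.* D₄ ℤ.* D₆ ; b = D₁ ℤ.* ℤ.+ 1272 ℤ.* D₄ ℤ.* D₆ ; Kc = refl ; Ks = refl }
  turn₄ = record
    { c = ℤ.+ 101123 / 101125 ; s = ℤ.+ 636 / 101125 ; unit = refl
    ; a = D₁ ℤ.* D₂ ℤ.* ℤ.+ 101123 ℤ.* D₆ ; b = D₁ ℤ.* D₂ ℤ.* ℤ.+ 636 ℤ.* D₆ ; Kc = refl ; Ks = refl }
  turn₆ = record
    { c = ℤ.+ 44943 / 44945 ; s = ℤ.+ 424 / 44945 ; unit = refl
    ; a = D₁ ℤ.* D₂ ℤ.* D₄ ℤ.* ℤ.+ 44943 ; b = D₁ ℤ.* D₂ ℤ.* D₄ ℤ.* ℤ.+ 424 ; Kc = refl ; Ks = refl }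

  0<K : 0ℚ < fromℤ K
  0<K = from-yes (0ℚ <? fromℤ K)

  checked : Certificate.run K 0<K turn₁ turn₂ turn₄ turn₆ N initial ≡ true
  -- The type checker evaluates the states up to step `N = 1998`, on integers of about the size of
  -- `K` to the power `N`.
  checked = refl

  open Certificate.Contradiction K 0<K turn₁ turn₂ turn₄ turn₆ checked
    (from-yes ((1ℚ - Turn.c turn₁) * (1ℚ - Turn.c turn₁) + Turn.s turn₁ * Turn.s turn₁ ≤? η₁ * η₁))
    (from-yes ((1ℚ - Turn.c turn₂) * (1ℚ - Turn.c turn₂) + Turn.s turn₂ * Turn.s turn₂ ≤? η₂ * η₂))
    (from-yes ((1ℚ - Turn.c turn₄) * (1ℚ - Turn.c turn₄) + Turn.s turn₄ * Turn.s turn₄ ≤? η₄ * η₄))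
    (from-yes ((1ℚ - Turn.c turn₆) * (1ℚ - Turn.c turn₆) + Turn.s turn₆ * Turn.s turn₆ ≤? η₆ * η₆))
    using (contradictory)

  -- Reduction of a covering set to whole blocks.

  absorb : ∀ c c′ d w n q x → suc c′ ≡ 2 ℕ.* c → c ℕ.* x ℕ.< n ℕ.* d → n ℕ.≤ w ℕ.* q ℕ.+ w →
           2 ℕ.* w ℕ.* d ℕ.≤ x → c′ ℕ.* x ℕ.≤ 2 ℕ.* w ℕ.* d ℕ.* q
  absorb c c′ d w n q x 1+c′≡2c large n≤ small = ℕ.+-cancelˡ-≤ x (c′ ℕ.* x) (2 ℕ.* w ℕ.* d ℕ.* q) (begin
    x ℕ.+ c′ ℕ.* x                                ≡⟨ cong (ℕ._* x) 1+c′≡2c ⟩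
    2 ℕ.* c ℕ.* x                                 ≡⟨ ℕ.*-assoc 2 c x ⟩
    2 ℕ.* (c ℕ.* x)                               ≤⟨ ℕ.*-monoʳ-≤ 2 (ℕ.<⇒≤ large) ⟩
    2 ℕ.* (n ℕ.* d)                               ≤⟨ ℕ.*-monoʳ-≤ 2 (ℕ.*-monoˡ-≤ d n≤) ⟩
    2 ℕ.* ((w ℕ.* q ℕ.+ w) ℕ.* d)                 ≡⟨ expand w d q ⟩
    -- The incomplete last block costs `2 * w * d`, paid for by one of the `2 * c` copies of `x`.
    -- Hence `c′ = 2 * c - 1`, which is 9577 for 4789.
    2 ℕ.* w ℕ.* d ℕ.+ 2 ℕ.* w ℕ.* d ℕ.* q         ≤⟨ ℕ.+-monoˡ-≤ (2 ℕ.* w ℕ.* d ℕ.* q) small ⟩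
    x ℕ.+ 2 ℕ.* w ℕ.* d ℕ.* q                     ∎)
    where
    open ℕ.≤-Reasoning
    expand : ∀ w d q → 2 ℕ.* ((w ℕ.* q ℕ.+ w) ℕ.* d) ≡ 2 ℕ.* w ℕ.* d ℕ.+ 2 ℕ.* w ℕ.* d ℕ.* q
    expand = ℕ.solve-∀

  -- Both summands of `m` are at most `m`, so removing the elements from `w` on loses no
  -- representation of a number below `w`.
  covers-below : ∀ A {n w} → Covers A n → w ℕ.≤ n → ∀ m → m ℕ.< w →
    ∃[ a ] ∃[ b ] (a ∈ filter (ℕ._<? w) A × b ∈ filter (ℕ._<? w) A × a ℕ.+ b ≡ m)
  covers-below A {w = w} covers w≤n m m<w with covers m (ℕ.<-≤-trans m<w w≤n)
  ... | a , b , a∈A , b∈A , refl = a , b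
    , ∈-filter⁺ (ℕ._<? w) a∈A (ℕ.≤-<-trans (ℕ.m≤m+n a b) m<w)
    , ∈-filter⁺ (ℕ._<? w) b∈A (ℕ.≤-<-trans (ℕ.m≤n+m b a) m<w)
    , refl

  -- If the bound failed, the elements below `N q` with `q = n / N` would still cover all numbers
  -- below `N q`, against `contradictory`. The slack there absorbs the linear errors once `k` is at
  -- least 20000, so no error term remains.
  covers⇒bound : ∀ k n A → length A ≡ k → Covers A n → 20000 ℕ.≤ k → n ℕ.* 10000 ℕ.≤ 4789 ℕ.* (k ℕ.* k)
  covers⇒bound k n A refl covers 20000≤k = ℕ.≮⇒≥ (λ large → refute (n ℕ./ N) refl large)
    where
    refute : ∀ q → n ℕ./ N ≡ q → 4789 ℕ.* (k ℕ.* k) ℕ.< n ℕ.* 10000 → ⊥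
    refute q n/N≡q large = go q Nq≤n main
      where
      n≤ : n ℕ.≤ N ℕ.* q ℕ.+ N
      n≤ = begin
        n                           ≡⟨ ℕ.m≡m%n+[m/n]*n n N ⟩
        n ℕ.% N ℕ.+ n ℕ./ N ℕ.* N   ≡⟨ cong (λ t → n ℕ.% N ℕ.+ t ℕ.* N) n/N≡q ⟩
        n ℕ.% N ℕ.+ q ℕ.* N         ≤⟨ ℕ.+-monoˡ-≤ (q ℕ.* N) (ℕ.<⇒≤ (ℕ.m%n<n n N)) ⟩
        N ℕ.+ q ℕ.* N               ≡⟨ ℕ.+-comm N (q ℕ.* N) ⟩
        q ℕ.* N ℕ.+ N               ≡⟨ cong (ℕ._+ N) (ℕ.*-comm q N) ⟩
        N ℕ.* q ℕ.+ N               ∎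
        where open ℕ.≤-Reasoning
      Nq≤n : N ℕ.* q ℕ.≤ n
      Nq≤n = subst₂ ℕ._≤_ (trans (cong (ℕ._* N) n/N≡q) (ℕ.*-comm q N)) refl (ℕ.m/n*n≤m n N)
      main : 9577 ℕ.* (k ℕ.* k) ℕ.≤ 2 ℕ.* N ℕ.* 10000 ℕ.* q
      main = absorb 4789 9577 10000 N n q (k ℕ.* k) refl large n≤
        (ℕ.≤-trans (from-yes (2 ℕ.* N ℕ.* 10000 ℕ.≤? 20000 ℕ.* 20000)) (ℕ.*-mono-≤ 20000≤k 20000≤k))
      0<kℕ : 0 ℕ.< k
      0<kℕ = ℕ.<-≤-trans ℕ.z<s 20000≤k
      -- Blocks must have positive length, so `q = 0` is separated: there the right side vanishes
      -- while `k` is positive.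
      go : ∀ q → N ℕ.* q ℕ.≤ n → 9577 ℕ.* (k ℕ.* k) ℕ.≤ (2 ℕ.* N ℕ.* 10000) ℕ.* q → ⊥
      go zero    _    p = ℕ.n≮0 (ℕ.<-≤-trans (ℕ.*-monoʳ-< 9577 (ℕ.*-mono-< 0<kℕ 0<kℕ)) p)
      go (suc q) Nq≤n p = contradictory (suc q) L (λ a∈L → proj₂ (∈-filter⁻ (ℕ._<? N ℕ.* suc q) {xs = A} a∈L))
        (covers-below A covers Nq≤n) (fromℕ k) 0<k
        (fromℕ-≤ (length-filter (ℕ._<? N ℕ.* suc q) A)) θk² δk²
        where
        L : List ℕ
        L = filter (ℕ._<? N ℕ.* suc q) A
        0<k : 0ℚ < fromℕ k
        0<k = <-≤-trans (from-yes (0ℚ <? 1ℚ)) (fromℕ-≤ 0<kℕ)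
        -- The denominator is `N * 10000`: by evaluation `unit₁ * fromℕ 9577` is `θ`, and `unit₁`
        -- times `2 * N * 10000` is 2.
        unit₁ : ℚ
        unit₁ = ℤ.+ 1 / 19980000
        θk² : θ * (fromℕ k * fromℕ k) ≤ fromℕ (suc q) + fromℕ (suc q)
        θk² = begin
          unit₁ * fromℕ 9577 * (fromℕ k * fromℕ k)     ≡⟨ *-assoc unit₁ (fromℕ 9577) (fromℕ k * fromℕ k) ⟩
          unit₁ * (fromℕ 9577 * (fromℕ k * fromℕ k))   ≡⟨ cong (unit₁ *_) (trans (fromℕ-* 9577 (k ℕ.* k)) (cong (fromℕ 9577 *_) (fromℕ-* k k))) ⟨
          unit₁ * fromℕ (9577 ℕ.* (k ℕ.* k))           ≤⟨ *-monoˡ {fromℕ (9577 ℕ.* (k ℕ.* k))} {fromℕ ((2 ℕ.* N ℕ.* 10000) ℕ.* suc q)} unit₁ (from-yes (0ℚ ≤? unit₁))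
              (fromℕ-≤ {9577 ℕ.* (k ℕ.* k)} {(2 ℕ.* N ℕ.* 10000) ℕ.* suc q} p) ⟩
          unit₁ * fromℕ ((2 ℕ.* N ℕ.* 10000) ℕ.* suc q)           ≡⟨ cong (unit₁ *_) (fromℕ-* (2 ℕ.* N ℕ.* 10000) (suc q)) ⟩
          unit₁ * (fromℕ (2 ℕ.* N ℕ.* 10000) * fromℕ (suc q))     ≡⟨ trans (sym (*-assoc unit₁ (fromℕ (2 ℕ.* N ℕ.* 10000)) (fromℕ (suc q)))) (cong (_* fromℕ (suc q)) cancel) ⟩
          (1ℚ + 1ℚ) * fromℕ (suc q)                    ≡⟨ double (fromℕ (suc q)) ⟩
          fromℕ (suc q) + fromℕ (suc q)                ∎
          where
          open ≤-Reasoning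
          cancel : unit₁ * fromℕ (2 ℕ.* N ℕ.* 10000) ≡ 1ℚ + 1ℚ
          cancel = refl
          double : ∀ x → (1ℚ + 1ℚ) * x ≡ x + x
          double = solve-∀ ring
        δk² : fromℕ k + fromℕ k ≤ δ * (fromℕ k * fromℕ k)
        δk² = begin
          fromℕ k + fromℕ k                     ≡⟨ double (fromℕ k) ⟨
          -- `δ * fromℕ 20000` evaluates to 2, so the threshold 20000 for `k` matches `δ`.
          δ * fromℕ 20000 * fromℕ k             ≡⟨ *-assoc δ (fromℕ 20000) (fromℕ k) ⟩
          δ * (fromℕ 20000 * fromℕ k)           ≤⟨ *-monoˡ δ (from-yes (0ℚ ≤? δ)) (*-monoʳ (fromℕ k) (0≤fromℕ k) (fromℕ-≤ 20000≤k)) ⟩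
          δ * (fromℕ k * fromℕ k)               ∎
          where
          open ≤-Reasoning
          double : ∀ x → (1ℚ + 1ℚ) * x ≡ x + x
          double = solve-∀ ring

-- The upper limit.

open import Data.Nat using (ℕ; suc; _+_; _*_; _≤_; _^_)

-- The upper limit in its ε form with `ε = 1 / suc d`: eventually `n / k² ≤ 0.4789 + ε`. For
-- `k ≥ 20000` even `n / k² ≤ 0.4789` has been proved, so one threshold serves every `d`.
theorem2 : ∀ (d : ℕ) → ∃[ K ] (∀ k n → K ≤ k → IsN2 k n →
    n * (10000 * suc d) ≤ (4789 * suc d + 10000) * k ^ 2)
theorem2 d = 20000 , λ { k n 20000≤k ((A , (_ , |A|≡k) , covers) , _) → begin
  n * (10000 * suc d)             ≡⟨ ℕ.*-assoc n 10000 (suc d) ⟨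
  n * 10000 * suc d               ≤⟨ ℕ.*-monoˡ-≤ (suc d) (Proof.covers⇒bound k n A |A|≡k covers 20000≤k) ⟩
  4789 * (k * k) * suc d          ≡⟨ rearrange 4789 k (suc d) ⟩
  4789 * suc d * k ^ 2            ≤⟨ ℕ.*-monoˡ-≤ (k ^ 2) (ℕ.m≤m+n (4789 * suc d) 10000) ⟩
  (4789 * suc d + 10000) * k ^ 2  ∎ }
  where
  open ℕ.≤-Reasoning
  rearrange : ∀ c k e → c * (k * k) * e ≡ c * e * (k * (k * 1))
  rearrange = ℕ.solve-∀
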